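{- Let $n\ge 7$ and let $\Gamma(G)$ be a signed graph whose underlying graph $G$ belongs to $B_n^+$. Then $\eta(\Gamma(G))\le n-6$.
   Context: A signed graph $\Gamma(G)=(G,\sigma)$ consists of a simple graph $G$ and a map $\sigma:E(G)\to\{+,-\}$; its adjacency matrix has entry $\sigma(v_iv_j)$ for edges and $0$ otherwise, and $\eta(\Gamma(G))$ is the multiplicity of $0$ as an eigenvalue. A bicyclic graph is a connected simple graph with $|E|=|V|+1$. The graph $\infty(p,q,l)$ ($p,q\ge3$, $l\ge1$) is obtained from vertex-disjoint cycles $C_p$, $C_q$ by joining a vertex of $C_p$ to a vertex of $C_q$ by a path on $l$ vertices (identifying the two vertices when $l=1$). $B_n^+$ is the set of bicyclic graphs on $n$ vertices obtained from some $\infty(p,q,l)$ with $l>1$ by (possibly) attaching trees to some of its vertices. -}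

module Defs where

open import Data.Nat as ℕ using (ℕ; zero; suc; _≤_; _<_)
open import Data.Integer as ℤ using (ℤ; +_; -_)
open import Data.Fin using (Fin; zero; suc; toℕ; punchIn)
open import Data.Fin.Properties using (_≟_)
open import Data.List using (List; []; _∷_; map; foldr; allFin; concatMap)
open import Data.Nat.ListAction using (sum)
open import Data.Bool using (Bool; true; false; if_then_else_; _∧_)
open import Data.Sign using (Sign)
open import Data.Product using (_×_; _,_)
open import Data.Sum using (_⊎_)
open import Function.Definitions using (Injective)
open import Relation.Binary.PropositionalEquality using (_≡_)
open import Relation.Nullary using (does)

record Graph (n : ℕ) : Set where
  field
    adj    : Fin n → Fin n → Bool
    sym    : ∀ i j → adj i j ≡ adj j i
    irrefl : ∀ i → adj i i ≡ false

open Graph public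

-- a signed graph: underlying simple graph plus a sign on each edge
-- (the sign function is given on all pairs, symmetric; only its values
-- on edges matter)
record SignedGraph (n : ℕ) : Set where
  field
    graph   : Graph n
    σ       : Fin n → Fin n → Sign
    σ-sym   : ∀ i j → σ i j ≡ σ j i

open SignedGraph public

data Reach {n : ℕ} (G : Graph n) : Fin n → Fin n → Set where
  here : ∀ {u} → Reach G u u
  step : ∀ {u w v} → adj G u w ≡ true → Reach G w v → Reach G u v

Connected : ∀ {n} → Graph n → Set
Connected G = ∀ u v → Reach G u v

edgeCount : ∀ {n} → Graph n → ℕ
edgeCount {n} G =
  sum (concatMap (λ i → map (λ j →
         if adj G i j ∧ (toℕ i ℕ.<ᵇ toℕ j) then 1 else 0) (allFin n)) (allFin n))

Bicyclic : ∀ {n} → Graph n → Set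
Bicyclic {n} G = Connected G × (edgeCount G ≡ suc n)

-- The graph ∞(p,q,l) on vertices 0 .. p+q+l-3:
--   C_p   = 0,1,...,p-1 (closed by the edge {0,p-1});
--   path  = p-1, p, ..., p+l-2   (l vertices);
--   C_q   = p+l-2, ..., p+l+q-3 (closed by the edge {p+l-2, p+l+q-3}).
-- Hence the edges are {i,i+1} for i+1 < p+q+l-2 together with the two
-- closing edges.

infSize : ℕ → ℕ → ℕ → ℕ
infSize p q l = p ℕ.+ q ℕ.+ l ℕ.∸ 2

data InfEdge (p q l : ℕ) : ℕ → ℕ → Set where
  chain   : ∀ i → suc i < infSize p q l → InfEdge p q l i (suc i)
  closeP  : InfEdge p q l 0 (p ℕ.∸ 1)
  closeQ  : InfEdge p q l (p ℕ.+ l ℕ.∸ 2) (p ℕ.+ q ℕ.+ l ℕ.∸ 3)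

InfAdj : (p q l : ℕ) → ℕ → ℕ → Set
InfAdj p q l i j = InfEdge p q l i j ⊎ InfEdge p q l j i

ContainsInf : ∀ {n} → Graph n → ℕ → ℕ → ℕ → Set
ContainsInf {n} G p q l =
  Data.Product.Σ (Fin (infSize p q l) → Fin n) λ φ →
    Injective _≡_ _≡_ φ ×
    (∀ a b → InfAdj p q l (toℕ a) (toℕ b) → adj G (φ a) (φ b) ≡ true)

-- B_n^+ : bicyclic graphs on n vertices obtained from some ∞(p,q,l),
-- l > 1, by attaching trees.  (For a connected graph with |E| = |V|+1,
-- containing ∞(p,q,l) as a subgraph is exactly being obtained from it by
-- attaching trees.)
InBplus : ∀ {n} → Graph n → Set
InBplus G = Bicyclic G ×
  Data.Product.∃ λ p → Data.Product.∃ λ q → Data.Product.∃ λ l →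
    3 ≤ p × 3 ≤ q × 2 ≤ l × ContainsInf G p q l

signℤ : Sign → ℤ
signℤ Sign.+ = + 1
signℤ Sign.- = - (+ 1)

adjMatrix : ∀ {n} → SignedGraph n → Fin n → Fin n → ℤ
adjMatrix Γ i j = if adj (graph Γ) i j then signℤ (σ Γ i j) else + 0

-- integer polynomials as coefficient lists, constant term first
Poly : Set
Poly = List ℤ

_+ₚ_ : Poly → Poly → Poly
[] +ₚ q = q
(a ∷ p) +ₚ [] = a ∷ p
(a ∷ p) +ₚ (b ∷ q) = (a ℤ.+ b) ∷ (p +ₚ q)

_*ₚ_ : Poly → Poly → Poly
[] *ₚ q = []
(a ∷ p) *ₚ q = map (a ℤ.*_) q +ₚ (+ 0 ∷ (p *ₚ q))

altSign : ℕ → ℤ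
altSign zero = + 1
altSign (suc zero) = - (+ 1)
altSign (suc (suc k)) = altSign k

det : ∀ n → (Fin n → Fin n → Poly) → Poly
det zero M = + 1 ∷ []
det (suc n) M =
  foldr _+ₚ_ []
    (map (λ j → ((altSign (toℕ j) ∷ []) *ₚ M zero j)
                 *ₚ det n (λ a b → M (suc a) (punchIn j b)))
         (allFin (suc n)))

charPoly : ∀ {n} → (Fin n → Fin n → ℤ) → Poly
charPoly {n} A = det n (λ i j →
  (if does (i ≟ j) then (+ 0 ∷ + 1 ∷ []) else []) +ₚ (ℤ.- A i j ∷ []))

zeroMult : Poly → ℕ
zeroMult [] = 0
zeroMult (c ∷ cs) = if does (c ℤ.≟ + 0) then suc (zeroMult cs) else 0

η : ∀ {n} → SignedGraph n → ℕ
η Γ = zeroMult (charPoly (adjMatrix Γ))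

{-# OPTIONS --safe #-}
-- Six consecutive vertices p-3, …, p+2 of ∞(p,q,l) induce a path with at most two chords,
-- since a further edge would be the (n+2)-nd edge of G; their principal submatrix is
-- nonsingular. For a symmetric matrix, deleting one index lowers the multiplicity of the
-- root 0 of the characteristic polynomial by at most one: with u(x) a row of the adjugate
-- of xI - A and φ, ψ the polynomials before and after deleting v,
--   φ(x)ψ(-x) - φ(-x)ψ(x) = 2x Σ_w u_w(x)u_w(-x),
-- and the lowest coefficient of the right-hand sum is ± a sum of squares. Deleting the
-- n - 6 other vertices leaves multiplicity 0. Polynomials are handled through their values
-- at integers.

module Submission where

open import Defs renaming (sym to adj-sym)
open import Data.Nat as ℕ using (ℕ; zero; suc; _≤_; _<_; _∸_; z≤n; s≤s)
import Data.Nat.Properties as ℕₚ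
import Data.Nat.ListAction as ListAction
open import Data.Nat.ListAction.Properties using (sum-++)
open import Data.Integer as ℤ using (ℤ; +_; -_; _+_; _*_; _^_; 0ℤ; 1ℤ; -[1+_]; ∣_∣)
import Data.Integer.Properties as ℤₚ
open import Data.Integer.Tactic.RingSolver using (solve-∀)
open import Data.Fin using (Fin; zero; suc; toℕ; fromℕ; fromℕ<; inject₁; punchIn; punchOut)
open import Data.Fin.Patterns
open import Data.Fin.Properties
  using (_≟_; any?; punchIn-punchOut; punchInᵢ≢i; punchIn-injective; suc-injective;
         toℕ-injective; toℕ-fromℕ<; toℕ-inject₁; toℕ-fromℕ; toℕ<n; toℕ≤pred[n])
open import Data.Fin.Induction using (<-weakInduction)
open import Data.Bool using (Bool; true; false; if_then_else_; _∨_; _∧_; T)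
open import Data.Bool.Properties using (T?)
open import Data.Maybe using (Maybe; just; nothing)
open import Data.Sign using (Sign)
open import Data.List
  using (List; []; _∷_; _++_; map; concatMap; foldr; allFin; tabulate; filter; length; cartesianProduct)
open import Data.List.Properties using (map-tabulate; length-tabulate; length-++; length-map; filter-++)
open import Data.List.Membership.Propositional using (_∈_; _∉_)
open import Data.List.Membership.Propositional.Properties
  using (∈-allFin; ∈-filter⁺; ∈-filter⁻; ∈-tabulate⁺; ∈-tabulate⁻; ∈-map⁻; ∈-cartesianProduct⁺;
         ∈-∃++; ∈-++⁺ˡ; ∈-++⁺ʳ; ∈-++⁻)
import Data.List.Membership.DecPropositional as DecMembership
open import Data.List.Relation.Unary.Any using (here; there)
open import Data.List.Relation.Unary.All as All using ([]; _∷_)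
import Data.List.Relation.Unary.All.Properties as Allₚ
open import Data.List.Relation.Unary.AllPairs using ([]; _∷_)
open import Data.List.Relation.Unary.Unique.Propositional using (Unique)
import Data.List.Relation.Unary.Unique.Propositional.Properties as Uniqueₚ
open import Data.Vec as Vec using (Vec; []; _∷_)
open import Data.Vec.Functional using (updateAt; insertAt)
open import Data.Vec.Functional.Properties
  using (updateAt-updates; updateAt-minimal; insertAt-lookup; insertAt-punchIn)
open import Data.Product using (∃; _×_; _,_; proj₁; proj₂)
open import Data.Sum using (_⊎_; inj₁; inj₂)
open import Function using (_∘_; const; id)
open import Function.Definitions using (Injective)
open import Relation.Nullary using (¬_; Dec; yes; no; does; contradiction; ¬?)
open import Relation.Nullary.Decidable
  using (True; False; toWitness; toWitnessFalse; map′; _×-dec_; _⊎-dec_)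
open import Relation.Binary.PropositionalEquality
  using (_≡_; _≢_; _≗_; refl; sym; trans; cong; cong₂; subst; subst₂; module ≡-Reasoning)
open import Algebra.Properties.Semiring.Sum ℤₚ.+-*-semiring
  using (sum; sum-cong-≗; ∑-distrib-+; ∑-comm; *-distribˡ-sum; *-distribʳ-sum; sum-replicate-zero)

-- The window is centred on the edge that leaves `C_p` because its six vertices have a single
-- perfect matching, 01, 23, 45, whether or not the chords 02 and 35 are present. The matching
-- contributes -1 to the determinant; the only other permutations that can contribute rotate both
-- triangles and add a multiple of 4. No choice of signs can therefore give 0.
--
-- `η` counts a root of the characteristic polynomial, so a bound on the rank does not suffice: the
-- nilpotent matrix with rows (1, 1) and (-1, -1) has a nonsingular principal submatrix of size 1
-- and still multiplicity 2. Symmetry enters through the bilinear identity and positivity through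
-- the sum of squares, with no eigenvalues involved. Values at integers are compared because a
-- coefficient list is not determined by its polynomial.
--
-- Deleted indices stay in the matrix as rows and columns of the identity, so deletions iterate
-- without reindexing. The surviving block must then be evaluated in scattered rows and columns;
-- uniqueness of the determinant among alternating functions does this.

-- Finite sums of integers and the Kronecker delta

sum-0 : ∀ {n} {f : Fin n → ℤ} → (∀ i → f i ≡ 0ℤ) → sum f ≡ 0ℤ
sum-0 {n} eq = trans (sum-cong-≗ eq) (sum-replicate-zero n)

sum-linear : ∀ {n} a (f g : Fin n → ℤ) →
             sum (λ i → a * f i + g i) ≡ a * sum f + sum g
sum-linear a f g = trans (∑-distrib-+ (λ i → a * f i) g)
                         (cong (_+ sum g) (sym (*-distribˡ-sum a f)))

sum-neg : ∀ {n} (f : Fin n → ℤ) → sum (λ i → - f i) ≡ - sum f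
sum-neg f = begin
  sum (λ i → - f i)        ≡⟨ sum-cong-≗ (λ i → sym (ℤₚ.-1*i≡-i (f i))) ⟩
  sum (λ i → - 1ℤ * f i)   ≡⟨ sym (*-distribˡ-sum (- 1ℤ) f) ⟩
  - 1ℤ * sum f             ≡⟨ ℤₚ.-1*i≡-i (sum f) ⟩
  - sum f                  ∎
  where open ≡-Reasoning

δ : ∀ {n} → Fin n → Fin n → ℤ
δ i j = if does (i ≟ j) then 1ℤ else 0ℤ

δ-refl : ∀ {n} (i : Fin n) → δ i i ≡ 1ℤ
δ-refl i with i ≟ i
... | yes _  = refl
... | no i≢i = contradiction refl i≢i

δ-≢ : ∀ {n} {i j : Fin n} → i ≢ j → δ i j ≡ 0ℤ
δ-≢ {i = i} {j} i≢j with i ≟ j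
... | yes i≡j = contradiction i≡j i≢j
... | no _    = refl

δ-suc : ∀ {n} (i j : Fin n) → δ (suc i) (suc j) ≡ δ i j
δ-suc i j with i ≟ j
... | yes _ = refl
... | no _  = refl

sum-δ : ∀ {n} (r : Fin n → ℤ) k → sum (λ t → r t * δ t k) ≡ r k
sum-δ r zero = begin
  r zero * 1ℤ + sum (λ t → r (suc t) * 0ℤ)
    ≡⟨ cong₂ _+_ (ℤₚ.*-identityʳ (r zero)) (sum-0 (λ t → ℤₚ.*-zeroʳ (r (suc t)))) ⟩
  r zero + 0ℤ ≡⟨ ℤₚ.+-identityʳ (r zero) ⟩
  r zero      ∎
  where open ≡-Reasoning
sum-δ r (suc k) = begin
  r zero * 0ℤ + sum (λ t → r (suc t) * δ (suc t) (suc k))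
    ≡⟨ cong₂ _+_ (ℤₚ.*-zeroʳ (r zero))
         (sum-cong-≗ (λ t → cong (r (suc t) *_) (δ-suc t k))) ⟩
  0ℤ + sum (λ t → r (suc t) * δ t k)  ≡⟨ ℤₚ.+-identityˡ _ ⟩
  sum (λ t → r (suc t) * δ t k)       ≡⟨ sum-δ (r ∘ suc) k ⟩
  r (suc k)                           ∎
  where open ≡-Reasoning

-- Alternating multilinear functions of the rows of an integer matrix

Matrix : ℕ → ℕ → Set
Matrix m n = Fin m → Fin n → ℤ

-- `linear` relates three matrices that agree pointwise off row `i`, instead of mentioning an
-- update: rows are functions, and every comparison of them is pointwise.
record Alternating {m n} (F : Matrix m n → ℤ) : Set where
  field
    cong-rows  : ∀ {M P} → (∀ i → M i ≗ P i) → F M ≡ F P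
    linear     : ∀ i a {M P Q} →
                 (∀ k → k ≢ i → M k ≗ P k) → (∀ k → k ≢ i → M k ≗ Q k) →
                 (∀ j → M i j ≡ a * P i j + Q i j) → F M ≡ a * F P + F Q
    equal-rows : ∀ {i j M} → i ≢ j → M i ≗ M j → F M ≡ 0ℤ

infixl 9 _[_≔_]
_[_≔_] : ∀ {m n} → Matrix m n → Fin m → (Fin n → ℤ) → Matrix m n
M [ i ≔ r ] = updateAt M i (const r)

≔-at : ∀ {m n} (M : Matrix m n) i r → (M [ i ≔ r ]) i ≡ r
≔-at M i r = updateAt-updates i M

≔-off : ∀ {m n} (M : Matrix m n) {i k} r → k ≢ i → (M [ i ≔ r ]) k ≡ M k
≔-off M {i} {k} r k≢i = updateAt-minimal k i M k≢i

≡⇒≗ : ∀ {n} {r s : Fin n → ℤ} → r ≡ s → r ≗ s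
≡⇒≗ refl _ = refl

≗-trans : ∀ {n} {r s t : Fin n → ℤ} → r ≗ s → s ≗ t → r ≗ t
≗-trans p q k = trans (p k) (q k)

≗-sym : ∀ {n} {r s : Fin n → ℤ} → r ≗ s → s ≗ r
≗-sym p k = sym (p k)

module AlternatingProperties {m n} {F : Matrix m n → ℤ} (alt : Alternating F) where
  open Alternating alt

  ≔-cong : ∀ (M : Matrix m n) i {r s} → r ≗ s → F (M [ i ≔ r ]) ≡ F (M [ i ≔ s ])
  ≔-cong M i {r} {s} r≗s = cong-rows rows
    where
    rows : ∀ k → (M [ i ≔ r ]) k ≗ (M [ i ≔ s ]) k
    rows k with k ≟ i
    ... | yes refl = ≗-trans (≡⇒≗ (≔-at M i r)) (≗-trans r≗s (≡⇒≗ (sym (≔-at M i s))))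
    ... | no k≢i   = ≡⇒≗ (trans (≔-off M r k≢i) (sym (≔-off M s k≢i)))

  ≔-self : ∀ (M : Matrix m n) i {r} → r ≗ M i → F (M [ i ≔ r ]) ≡ F M
  ≔-self M i {r} r≗ = cong-rows rows
    where
    rows : ∀ k → (M [ i ≔ r ]) k ≗ M k
    rows k with k ≟ i
    ... | yes refl = ≗-trans (≡⇒≗ (≔-at M i r)) r≗
    ... | no k≢i   = ≡⇒≗ (≔-off M r k≢i)

  ≔-linear : ∀ (M : Matrix m n) i a r s →
             F (M [ i ≔ (λ k → a * r k + s k) ]) ≡ a * F (M [ i ≔ r ]) + F (M [ i ≔ s ])
  ≔-linear M i a r s = linear i a
    (λ k k≢i → ≡⇒≗ (trans (≔-off M _ k≢i) (sym (≔-off M _ k≢i))))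
    (λ k k≢i → ≡⇒≗ (trans (≔-off M _ k≢i) (sym (≔-off M _ k≢i))))
    (λ j → trans (≡⇒≗ (≔-at M i _) j)
                 (sym (cong₂ (λ x y → a * x + y) (≡⇒≗ (≔-at M i r) j) (≡⇒≗ (≔-at M i s) j))))

  ≔-+ : ∀ (M : Matrix m n) i r s →
        F (M [ i ≔ (λ k → r k + s k) ]) ≡ F (M [ i ≔ r ]) + F (M [ i ≔ s ])
  ≔-+ M i r s = begin
    F (M [ i ≔ (λ k → r k + s k) ])
      ≡⟨ ≔-cong M i (λ k → cong (_+ s k) (sym (ℤₚ.*-identityˡ (r k)))) ⟩
    F (M [ i ≔ (λ k → 1ℤ * r k + s k) ])     ≡⟨ ≔-linear M i 1ℤ r s ⟩
    1ℤ * F (M [ i ≔ r ]) + F (M [ i ≔ s ])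
      ≡⟨ cong (_+ F (M [ i ≔ s ])) (ℤₚ.*-identityˡ (F (M [ i ≔ r ]))) ⟩
    F (M [ i ≔ r ]) + F (M [ i ≔ s ])        ∎
    where open ≡-Reasoning

  ≔-0 : ∀ (M : Matrix m n) i → F (M [ i ≔ const 0ℤ ]) ≡ 0ℤ
  ≔-0 M i = trans (≔-linear M i (- 1ℤ) (const 0ℤ) (const 0ℤ)) (cancel (F (M [ i ≔ const 0ℤ ])))
    where
    cancel : ∀ x → - 1ℤ * x + x ≡ 0ℤ
    cancel x = trans (cong (_+ x) (ℤₚ.-1*i≡-i x)) (ℤₚ.+-inverseˡ x)

  ≔-sum : ∀ (M : Matrix m n) i {p} (a : Fin p → ℤ) (R : Matrix p n) →
          F (M [ i ≔ (λ k → sum (λ t → a t * R t k)) ]) ≡ sum (λ t → a t * F (M [ i ≔ R t ]))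
  ≔-sum M i {zero}  a R = ≔-0 M i
  ≔-sum M i {suc p} a R =
    trans (≔-linear M i (a zero) (R zero) _)
          (cong (λ y → a zero * F (M [ i ≔ R zero ]) + y) (≔-sum M i (a ∘ suc) (R ∘ suc)))

  ≔-expand : ∀ (M : Matrix m n) i r →
             F (M [ i ≔ r ]) ≡ sum (λ t → r t * F (M [ i ≔ δ t ]))
  ≔-expand M i r = trans (≔-cong M i (λ k → sym (sum-δ r k))) (≔-sum M i r δ)

  ≔-duplicate : ∀ (M : Matrix m n) {i j} → i ≢ j → F (M [ i ≔ M j ]) ≡ 0ℤ
  ≔-duplicate M {i} {j} i≢j = equal-rows i≢j
    (≡⇒≗ (trans (≔-at M i _) (sym (≔-off M _ (i≢j ∘ sym)))))

  -- Polarisation: with the sum of the two rows placed in both positions `F` vanishes, and of the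
  -- four terms of the expansion the two with equal rows vanish as well.
  swap : ∀ {i j M P} → i ≢ j → P i ≗ M j → P j ≗ M i →
         (∀ k → k ≢ i → k ≢ j → P k ≗ M k) → F P ≡ - F M
  swap {i} {j} {M} {P} i≢j Pi Pj Pk = inverse (begin
    F P + F M
      ≡⟨ cong₂ _+_ (cong-rows P≗) (cong-rows M≗) ⟩
    G (M j) (M i) + G (M i) (M j)
      ≡⟨ rearrange {G (M j) (M i)} {G (M i) (M j)} (equal (M i)) (equal (M j)) ⟩
    (G (M i) (M i) + G (M i) (M j)) + (G (M j) (M i) + G (M j) (M j))
      ≡⟨ cong₂ _+_ (sym (≔-+ (M [ i ≔ M i ]) j (M i) (M j)))
                   (sym (≔-+ (M [ i ≔ M j ]) j (M i) (M j))) ⟩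
    G (M i) both + G (M j) both
      ≡⟨ cong₂ _+_ (commute (M i)) (commute (M j)) ⟩
    F (M [ j ≔ both ] [ i ≔ M i ]) + F (M [ j ≔ both ] [ i ≔ M j ])
      ≡⟨ sym (≔-+ (M [ j ≔ both ]) i (M i) (M j)) ⟩
    F (M [ j ≔ both ] [ i ≔ both ])
      ≡⟨ sym (commute both) ⟩
    G both both
      ≡⟨ equal both ⟩
    0ℤ ∎)
    where
    open ≡-Reasoning
    G : (Fin n → ℤ) → (Fin n → ℤ) → ℤ
    G r s = F (M [ i ≔ r ] [ j ≔ s ])
    both : Fin n → ℤ
    both k = M i k + M j k
    row-i : ∀ r s → (M [ i ≔ r ] [ j ≔ s ]) i ≡ r
    row-i r s = trans (≔-off (M [ i ≔ r ]) s i≢j) (≔-at M i r)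
    row-j : ∀ r s → (M [ i ≔ r ] [ j ≔ s ]) j ≡ s
    row-j r s = ≔-at (M [ i ≔ r ]) j s
    row-k : ∀ r s {k} → k ≢ i → k ≢ j → (M [ i ≔ r ] [ j ≔ s ]) k ≡ M k
    row-k r s k≢i k≢j = trans (≔-off (M [ i ≔ r ]) s k≢j) (≔-off M r k≢i)
    equal : ∀ r → G r r ≡ 0ℤ
    equal r = equal-rows i≢j (≡⇒≗ (trans (row-i r r) (sym (row-j r r))))
    rows : ∀ N {r s} → N i ≗ r → N j ≗ s → (∀ k → k ≢ i → k ≢ j → N k ≗ M k) →
           ∀ k → N k ≗ (M [ i ≔ r ] [ j ≔ s ]) k
    rows N {r} {s} Ni Nj Nk k with k ≟ i | k ≟ j
    ... | yes refl | _        = ≗-trans Ni (≡⇒≗ (sym (row-i r s)))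
    ... | no _     | yes refl = ≗-trans Nj (≡⇒≗ (sym (row-j r s)))
    ... | no k≢i   | no k≢j   = ≗-trans (Nk k k≢i k≢j) (≡⇒≗ (sym (row-k r s k≢i k≢j)))
    P≗ : ∀ k → P k ≗ (M [ i ≔ M j ] [ j ≔ M i ]) k
    P≗ = rows P Pi Pj Pk
    M≗ : ∀ k → M k ≗ (M [ i ≔ M i ] [ j ≔ M j ]) k
    M≗ = rows M (λ _ → refl) (λ _ → refl) (λ _ _ _ _ → refl)
    commute : ∀ r {s} → G r s ≡ F (M [ j ≔ s ] [ i ≔ r ])
    commute r {s} = sym (cong-rows (rows (M [ j ≔ s ] [ i ≔ r ])
      (≡⇒≗ (≔-at (M [ j ≔ s ]) i r))
      (≡⇒≗ (trans (≔-off (M [ j ≔ s ]) r (i≢j ∘ sym)) (≔-at M j s)))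
      (λ k k≢i k≢j → ≡⇒≗ (trans (≔-off (M [ j ≔ s ]) r k≢i) (≔-off M s k≢j)))))
    rearrange : ∀ {a b x y} → x ≡ 0ℤ → y ≡ 0ℤ → a + b ≡ (x + b) + (a + y)
    rearrange {a} {b} refl refl =
      trans (ℤₚ.+-comm a b) (sym (cong₂ _+_ (ℤₚ.+-identityˡ b) (ℤₚ.+-identityʳ a)))
    inverse : ∀ {x y} → x + y ≡ 0ℤ → x ≡ - y
    inverse {x} {y} eq = ℤₚ.i-j≡0⇒i≡j x (- y) (trans (cong (λ z → x + z) (ℤₚ.neg-involutive y)) eq)

  -- The list in `go` holds the rows where `P` may still differ from `M`. Resetting row `x` splits
  -- off a term in which row `v` occurs twice. Since `c v ≡ 0ℤ`, row `v` never changes, so the same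
  -- row serves for every `x`.
  add-multiples : ∀ v (c : Fin m → ℤ) {M P} → c v ≡ 0ℤ →
                  (∀ i k → P i k ≡ c i * M v k + M i k) → F P ≡ F M
  add-multiples v c {M} cv≡0 = go (allFin m) c cv≡0 (λ i i∉ → contradiction (∈-allFin i) i∉)
    where
    go : ∀ L (c : Fin m → ℤ) {P} → c v ≡ 0ℤ → (∀ i → i ∉ L → P i ≗ M i) →
         (∀ i k → P i k ≡ c i * M v k + M i k) → F P ≡ F M
    go []      c cv≡0 off _ = cong-rows (λ i → off i (λ ()))
    go (x ∷ L) c {P} cv≡0 off eq with x ≟ v
    ... | yes refl = go L c cv≡0 off′ eq
      where
      off′ : ∀ i → i ∉ L → P i ≗ M i
      off′ i i∉L with i ≟ x
      ... | yes refl = λ k → trans (eq x k) (trans (cong (λ z → z * M x k + M x k) cv≡0)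
                         (trans (cong (_+ M x k) (ℤₚ.*-zeroˡ (M x k))) (ℤₚ.+-identityˡ _)))
      ... | no i≢x = off i λ { (here p) → i≢x p ; (there q) → i∉L q }
    ... | no x≢v = begin
      F P ≡⟨ sym (≔-self P x (λ k → sym (eq x k))) ⟩
      F (P [ x ≔ (λ k → c x * M v k + M x k) ]) ≡⟨ ≔-linear P x (c x) (M v) (M x) ⟩
      c x * F (P [ x ≔ M v ]) + F (P [ x ≔ M x ])
        ≡⟨ cong₂ (λ y z → c x * y + z) duplicate
             (go L (updateAt c x (const 0ℤ)) c′v≡0 off′ eq′) ⟩
      c x * 0ℤ + F M ≡⟨ cong (_+ F M) (ℤₚ.*-zeroʳ (c x)) ⟩
      0ℤ + F M ≡⟨ ℤₚ.+-identityˡ _ ⟩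
      F M ∎
      where
      open ≡-Reasoning
      Pv≗ : P v ≗ M v
      Pv≗ k = trans (eq v k) (trans (cong (λ z → z * M v k + M v k) cv≡0)
                (trans (cong (_+ M v k) (ℤₚ.*-zeroˡ (M v k))) (ℤₚ.+-identityˡ _)))
      duplicate : F (P [ x ≔ M v ]) ≡ 0ℤ
      duplicate = trans (≔-cong P x (≗-sym Pv≗)) (≔-duplicate P x≢v)
      c′v≡0 : updateAt c x (const 0ℤ) v ≡ 0ℤ
      c′v≡0 = trans (updateAt-minimal v x c (x≢v ∘ sym)) cv≡0
      off′ : ∀ i → i ∉ L → (P [ x ≔ M x ]) i ≗ M i
      off′ i i∉L with i ≟ x
      ... | yes refl = ≡⇒≗ (≔-at P x _)
      ... | no i≢x   = ≗-trans (≡⇒≗ (≔-off P _ i≢x))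
                         (off i λ { (here p) → i≢x p ; (there q) → i∉L q })
      eq′ : ∀ i k → (P [ x ≔ M x ]) i k ≡ updateAt c x (const 0ℤ) i * M v k + M i k
      eq′ i k with i ≟ x
      ... | yes refl = trans (≡⇒≗ (≔-at P x _) k) (sym
                         (trans (cong (λ z → z * M v k + M x k) (updateAt-updates x c))
                         (trans (cong (_+ M x k) (ℤₚ.*-zeroˡ (M v k))) (ℤₚ.+-identityˡ _))))
      ... | no i≢x   = trans (≡⇒≗ (≔-off P _ i≢x) k) (trans (eq i k)
                         (cong (λ z → z * M v k + M i k) (sym (updateAt-minimal i x c i≢x))))

-- Determinants

minor : ∀ {m n} → Matrix (suc m) (suc n) → Fin (suc n) → Matrix m n
minor M j a b = M (suc a) (punchIn j b)

detℤ : ∀ n → Matrix n n → ℤ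
detℤ zero    M = 1ℤ
detℤ (suc n) M = sum (λ j → (altSign (toℕ j) * M zero j) * detℤ n (minor M j))

laplace : ∀ {n} → Matrix (suc n) (suc n) → Fin (suc n) → ℤ
laplace {n} M j = (altSign (toℕ j) * M zero j) * detℤ n (minor M j)

detℤ-cong : ∀ n {M P : Matrix n n} → (∀ i → M i ≗ P i) → detℤ n M ≡ detℤ n P
detℤ-cong zero    eq = refl
detℤ-cong (suc n) eq = sum-cong-≗ (λ j →
  cong₂ _*_ (cong (altSign (toℕ j) *_) (eq zero j))
            (detℤ-cong n (λ a b → eq (suc a) (punchIn j b))))

detℤ-linear : ∀ n i a {M P Q : Matrix n n} →
  (∀ k → k ≢ i → M k ≗ P k) → (∀ k → k ≢ i → M k ≗ Q k) →
  (∀ j → M i j ≡ a * P i j + Q i j) → detℤ n M ≡ a * detℤ n P + detℤ n Q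
detℤ-linear (suc n) zero a {M} {P} {Q} MP MQ eq =
  trans (sum-cong-≗ term) (sum-linear a (laplace P) (laplace Q))
  where
  distribute : ∀ s a p q d → (s * (a * p + q)) * d ≡ a * ((s * p) * d) + (s * q) * d
  distribute = solve-∀
  term : ∀ j → (altSign (toℕ j) * M zero j) * detℤ n (minor M j) ≡
               a * ((altSign (toℕ j) * P zero j) * detℤ n (minor P j))
                 + (altSign (toℕ j) * Q zero j) * detℤ n (minor Q j)
  term j = begin
    (s * M zero j) * detℤ n (minor M j)
      ≡⟨ cong (λ x → (s * x) * detℤ n (minor M j)) (eq j) ⟩
    (s * (a * P zero j + Q zero j)) * detℤ n (minor M j)
      ≡⟨ distribute s a (P zero j) (Q zero j) (detℤ n (minor M j)) ⟩
    a * ((s * P zero j) * detℤ n (minor M j)) + (s * Q zero j) * detℤ n (minor M j)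
      ≡⟨ cong₂ (λ x y → a * ((s * P zero j) * x) + (s * Q zero j) * y)
           (detℤ-cong n (λ i b → MP (suc i) (λ ()) (punchIn j b)))
           (detℤ-cong n (λ i b → MQ (suc i) (λ ()) (punchIn j b))) ⟩
    a * ((s * P zero j) * detℤ n (minor P j)) + (s * Q zero j) * detℤ n (minor Q j) ∎
    where
    open ≡-Reasoning
    s = altSign (toℕ j)
detℤ-linear (suc n) (suc i) a {M} {P} {Q} MP MQ eq =
  trans (sum-cong-≗ term) (sum-linear a (laplace P) (laplace Q))
  where
  distribute : ∀ c a p q → c * (a * p + q) ≡ a * (c * p) + c * q
  distribute = solve-∀
  term : ∀ j → (altSign (toℕ j) * M zero j) * detℤ n (minor M j) ≡
               a * ((altSign (toℕ j) * P zero j) * detℤ n (minor P j))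
                 + (altSign (toℕ j) * Q zero j) * detℤ n (minor Q j)
  term j = begin
    (s * M zero j) * detℤ n (minor M j)
      ≡⟨ cong ((s * M zero j) *_) (detℤ-linear n i a
           (λ k k≢i b → MP (suc k) (k≢i ∘ suc-injective) (punchIn j b))
           (λ k k≢i b → MQ (suc k) (k≢i ∘ suc-injective) (punchIn j b))
           (λ b → eq (punchIn j b))) ⟩
    (s * M zero j) * (a * detℤ n (minor P j) + detℤ n (minor Q j))
      ≡⟨ distribute (s * M zero j) a (detℤ n (minor P j)) (detℤ n (minor Q j)) ⟩
    a * ((s * M zero j) * detℤ n (minor P j)) + (s * M zero j) * detℤ n (minor Q j)
      ≡⟨ cong₂ (λ x y → a * ((s * x) * detℤ n (minor P j)) + (s * y) * detℤ n (minor Q j))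
           (MP zero (λ ()) j) (MQ zero (λ ()) j) ⟩
    a * ((s * P zero j) * detℤ n (minor P j)) + (s * Q zero j) * detℤ n (minor Q j) ∎
    where
    open ≡-Reasoning
    s = altSign (toℕ j)

altSign-suc : ∀ k → altSign (suc k) ≡ - altSign k
altSign-suc zero          = refl
altSign-suc (suc zero)    = refl
altSign-suc (suc (suc k)) = altSign-suc k

-- The pairs (j , punchIn j k) run over the ordered pairs of distinct indices;
-- exchanging the two indices is the map (inject₁ j , k) ↔ (suc k , j) for j ≤ k.
sum-antisymmetric : ∀ {n} (h : Fin (suc n) → Fin n → ℤ) →
  (∀ j k → toℕ j ≤ toℕ k → h (inject₁ j) k ≡ - h (suc k) j) →
  sum (λ j → sum (h j)) ≡ 0ℤ
sum-antisymmetric {zero}  h anti = refl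
sum-antisymmetric {suc n} h anti = begin
  sum (h zero) + sum (λ j → h (suc j) zero + sum (λ k → h (suc j) (suc k)))
    ≡⟨ cong₂ _+_ (sum-cong-≗ (λ k → anti zero k z≤n))
         (∑-distrib-+ (λ j → h (suc j) zero) (λ j → sum (λ k → h (suc j) (suc k)))) ⟩
  sum (λ k → - h (suc k) zero) +
    (sum (λ j → h (suc j) zero) + sum (λ j → sum (λ k → h (suc j) (suc k))))
    ≡⟨ cong₂ (λ x y → x + (sum (λ j → h (suc j) zero) + y))
         (sum-neg (λ k → h (suc k) zero))
         (sum-antisymmetric (λ j k → h (suc j) (suc k)) (λ j k j≤k → anti (suc j) (suc k) (s≤s j≤k))) ⟩
  - sum (λ k → h (suc k) zero) + (sum (λ j → h (suc j) zero) + 0ℤ)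
    ≡⟨ cancel (sum (λ k → h (suc k) zero)) ⟩
  0ℤ ∎
  where
  open ≡-Reasoning
  cancel : ∀ x → - x + (x + 0ℤ) ≡ 0ℤ
  cancel x = trans (cong (λ y → - x + y) (ℤₚ.+-identityʳ x)) (ℤₚ.+-inverseˡ x)

punchIn-inject₁ : ∀ {n} (j k : Fin n) → toℕ j ≤ toℕ k → punchIn (inject₁ j) k ≡ suc k
punchIn-inject₁ zero    k       _         = refl
punchIn-inject₁ (suc j) (suc k) (s≤s j≤k) = cong suc (punchIn-inject₁ j k j≤k)

punchIn-suc : ∀ {n} (j k : Fin n) → toℕ j ≤ toℕ k → punchIn (suc k) j ≡ inject₁ j
punchIn-suc zero    k       _         = refl
punchIn-suc (suc j) (suc k) (s≤s j≤k) = cong suc (punchIn-suc j k j≤k)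

-- A simplicial identity: both sides skip the columns `j` and `k + 1`, in the two possible orders.
punchIn-comm : ∀ {n} (j k : Fin (suc n)) → toℕ j ≤ toℕ k → ∀ b →
  punchIn (inject₁ j) (punchIn k b) ≡ punchIn (suc k) (punchIn j b)
punchIn-comm zero    k       _         b       = refl
punchIn-comm (suc j) (suc k) (s≤s j≤k) zero    = refl
punchIn-comm (suc j) (suc k) (s≤s j≤k) (suc b) = cong suc (punchIn-comm j k j≤k b)

-- Expansion along the two top rows runs over ordered pairs of distinct columns. When the rows
-- agree, exchanging the two columns keeps the entries and the remaining minor; the larger column
-- has index `k` as second choice but `k + 1` as first choice, which reverses the sign.
detℤ-equal₀₁ : ∀ n (M : Matrix (2 ℕ.+ n) (2 ℕ.+ n)) →
               M zero ≗ M (suc zero) → detℤ (2 ℕ.+ n) M ≡ 0ℤ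
detℤ-equal₀₁ n M eq = trans (sum-cong-≗ expand) (sum-antisymmetric h anti)
  where
  open ≡-Reasoning
  h : Fin (2 ℕ.+ n) → Fin (suc n) → ℤ
  h j k = (altSign (toℕ j) * M zero j) *
          ((altSign (toℕ k) * M (suc zero) (punchIn j k)) * detℤ n (minor (minor M j) k))
  expand : ∀ j → (altSign (toℕ j) * M zero j) * detℤ (suc n) (minor M j) ≡ sum (h j)
  expand j = *-distribˡ-sum (altSign (toℕ j) * M zero j) (λ k → (altSign (toℕ k) * M (suc zero) (punchIn j k)) * detℤ n (minor (minor M j) k))
  rearrange : ∀ s t x y d → (s * x) * ((t * y) * d) ≡ - ((- t * y) * ((s * x) * d))
  rearrange = solve-∀
  anti : ∀ j k → toℕ j ≤ toℕ k → h (inject₁ j) k ≡ - h (suc k) j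
  anti j k j≤k = begin
    (altSign (toℕ (inject₁ j)) * M zero (inject₁ j)) *
      ((altSign (toℕ k) * M (suc zero) (punchIn (inject₁ j) k)) * detℤ n (minor (minor M (inject₁ j)) k))
      ≡⟨ cong₂ _*_
           (cong₂ _*_ (cong altSign (toℕ-inject₁ j))
              (trans (eq (inject₁ j)) (cong (M (suc zero)) (sym (punchIn-suc j k j≤k)))))
           (cong₂ (λ x y → (altSign (toℕ k) * x) * y)
              (trans (sym (eq _)) (cong (M zero) (punchIn-inject₁ j k j≤k)))
              (detℤ-cong n (λ a b → cong (M (suc (suc a))) (punchIn-comm j k j≤k b)))) ⟩
    (altSign (toℕ j) * M (suc zero) (punchIn (suc k) j)) *
      ((altSign (toℕ k) * M zero (suc k)) * detℤ n (minor (minor M (suc k)) j))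
      ≡⟨ rearrange (altSign (toℕ j)) (altSign (toℕ k)) _ _ _ ⟩
    - ((- altSign (toℕ k) * M zero (suc k)) *
      ((altSign (toℕ j) * M (suc zero) (punchIn (suc k) j)) * detℤ n (minor (minor M (suc k)) j)))
      ≡⟨ cong (λ s → - ((s * M zero (suc k)) *
           ((altSign (toℕ j) * M (suc zero) (punchIn (suc k) j)) * detℤ n (minor (minor M (suc k)) j))))
           (sym (altSign-suc (toℕ k))) ⟩
    - h (suc k) j ∎

detℤ-minors-0 : ∀ n {M : Matrix (suc n) (suc n)} →
                (∀ j → detℤ n (minor M j) ≡ 0ℤ) → detℤ (suc n) M ≡ 0ℤ
detℤ-minors-0 n {M} eq = sum-0 (λ j →
  trans (cong ((altSign (toℕ j) * M zero j) *_) (eq j)) (ℤₚ.*-zeroʳ (altSign (toℕ j) * M zero j)))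

-- The row equal to row zero is exchanged with row one. Row zero stays in place, so the exchange
-- happens inside each minor, where alternation in size `n` is at hand; the equal rows then lie on
-- top.
detℤ-equal-head : ∀ n {M : Matrix (suc n) (suc n)} j → Alternating (detℤ n) →
                  M zero ≗ M (suc j) → detℤ (suc n) M ≡ 0ℤ
detℤ-equal-head (suc n) {M} zero    _   eq = detℤ-equal₀₁ n M eq
detℤ-equal-head (suc n) {M} (suc j) alt eq = begin
  detℤ (2 ℕ.+ n) M      ≡⟨ ℤₚ.neg-involutive _ ⟨
  - - detℤ (2 ℕ.+ n) M  ≡⟨ cong -_ (trans (sym swapped) (detℤ-equal₀₁ n P eq)) ⟩
  0ℤ                    ∎
  where
  open ≡-Reasoning
  P : Matrix (2 ℕ.+ n) (2 ℕ.+ n)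
  P zero             = M zero
  P (suc zero)       = M (suc (suc j))
  P (suc (suc k))    = (M [ suc (suc j) ≔ M (suc zero) ]) (suc (suc k))
  minor-swap : ∀ c → detℤ (suc n) (minor P c) ≡ - detℤ (suc n) (minor M c)
  minor-swap c = AlternatingProperties.swap alt {zero} {suc j}
    {minor M c} {minor P c} (λ ())
    (λ _ → refl)
    (λ b → ≡⇒≗ (≔-at M (suc (suc j)) (M (suc zero))) (punchIn c b))
    λ { zero 0≢0 _ → contradiction refl 0≢0
      ; (suc k) _ k≢j b → ≡⇒≗ (≔-off M (M (suc zero)) (k≢j ∘ suc-injective)) (punchIn c b) }
  pull : ∀ x y → x * - y ≡ - (x * y)
  pull x y = sym (ℤₚ.neg-distribʳ-* x y)
  swapped : detℤ (2 ℕ.+ n) P ≡ - detℤ (2 ℕ.+ n) M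
  swapped = trans (sum-cong-≗ (λ c →
    trans (cong ((altSign (toℕ c) * M zero c) *_) (minor-swap c)) (pull (altSign (toℕ c) * M zero c) _))) (sum-neg (laplace M))

-- Mutual recursion on the size: equal rows in size `n + 1` call for alternation of the minors of
-- size `n`.
detℤ-alternating : ∀ n → Alternating (detℤ n)
detℤ-equal-rows : ∀ n {i j} {M : Matrix n n} → i ≢ j → M i ≗ M j → detℤ n M ≡ 0ℤ

detℤ-alternating n = record
  { cong-rows  = detℤ-cong n
  ; linear     = λ i a → detℤ-linear n i a
  ; equal-rows = detℤ-equal-rows n
  }

detℤ-equal-rows (suc n) {zero}  {zero}  i≢j _  = contradiction refl i≢j
detℤ-equal-rows (suc n) {suc i} {suc j} {M} i≢j eq = detℤ-minors-0 n {M} (λ c →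
  detℤ-equal-rows n {M = minor M c} (i≢j ∘ cong suc) (λ b → eq (punchIn c b)))
detℤ-equal-rows (suc n) {suc i} {zero}  {M} _   eq =
  detℤ-equal-head n {M} i (detℤ-alternating n) (≗-sym eq)
detℤ-equal-rows (suc n) {zero}  {suc j} {M} _   eq =
  detℤ-equal-head n {M} j (detℤ-alternating n) eq

-- Uniqueness of the determinant among alternating functions

punchIn-cases : ∀ {n} (P : Fin (suc n) → Set) j → P j → (∀ k → P (punchIn j k)) → ∀ c → P c
punchIn-cases P j at off c with j ≟ c
... | yes refl = at
... | no j≢c   = subst P (punchIn-punchOut j≢c) (off (punchOut j≢c))

-- The shape left when a unit vector in row zero has cleared column `j` below it. Seen as a function
-- of `X`, it lowers the size in `alternating-unique` by one.
cone : ∀ {m} → Fin (suc m) → Matrix m m → Matrix (suc m) (suc m)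
cone j X zero    = δ j
cone j X (suc a) = insertAt (X a) j 0ℤ

cone-alternating : ∀ {m} {F : Matrix (suc m) (suc m) → ℤ} → Alternating F →
                   ∀ j → Alternating (F ∘ cone j)
cone-alternating {m} alt j = record
  { cong-rows  = λ eq → cong-rows λ { zero _ → refl ; (suc i) → lift (eq i) }
  ; linear     = λ i a {M} {P} {Q} MP MQ eq → linear (suc i) a
      (λ { zero _ _ → refl ; (suc k) k≢i → lift (MP k (k≢i ∘ cong suc)) })
      (λ { zero _ _ → refl ; (suc k) k≢i → lift (MQ k (k≢i ∘ cong suc)) })
      (punchIn-cases _ j
        (trans (insertAt-lookup (M i) j 0ℤ) (sym (trans
          (cong₂ (λ x y → a * x + y) (insertAt-lookup (P i) j 0ℤ) (insertAt-lookup (Q i) j 0ℤ))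
          (trans (ℤₚ.+-identityʳ _) (ℤₚ.*-zeroʳ a)))))
        (λ k → trans (insertAt-punchIn (M i) j 0ℤ k) (trans (eq k) (sym
          (cong₂ (λ x y → a * x + y) (insertAt-punchIn (P i) j 0ℤ k) (insertAt-punchIn (Q i) j 0ℤ k))))))
  ; equal-rows = λ i≢k eq → equal-rows (i≢k ∘ suc-injective) (lift eq)
  }
  where
  open Alternating alt
  lift : ∀ {r s : Fin m → ℤ} → r ≗ s → insertAt r j 0ℤ ≗ insertAt s j 0ℤ
  lift {r} {s} r≗s = punchIn-cases _ j
    (trans (insertAt-lookup r j 0ℤ) (sym (insertAt-lookup s j 0ℤ)))
    (λ k → trans (insertAt-punchIn r j 0ℤ k) (trans (r≗s k) (sym (insertAt-punchIn s j 0ℤ k))))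

punchIn-inject₁-self : ∀ {n} (i : Fin n) → punchIn (inject₁ i) i ≡ suc i
punchIn-inject₁-self i = punchIn-inject₁ i i ℕₚ.≤-refl

punchIn-suc-self : ∀ {n} (i : Fin n) → punchIn (suc i) i ≡ inject₁ i
punchIn-suc-self i = punchIn-suc i i ℕₚ.≤-refl

punchIn-suc-≢ : ∀ {n} (i k : Fin n) → k ≢ i → punchIn (suc i) k ≡ punchIn (inject₁ i) k
punchIn-suc-≢ zero    zero    k≢i = contradiction refl k≢i
punchIn-suc-≢ zero    (suc k) k≢i = refl
punchIn-suc-≢ (suc i) zero    k≢i = refl
punchIn-suc-≢ (suc i) (suc k) k≢i = cong suc (punchIn-suc-≢ i k (k≢i ∘ cong suc))

δ-punchIn : ∀ {n} j (a k : Fin n) → δ (punchIn j a) (punchIn j k) ≡ δ a k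
δ-punchIn j a k with a ≟ k
... | yes refl = δ-refl (punchIn j a)
... | no a≢k   = δ-≢ (a≢k ∘ punchIn-injective j a k)

-- The rows of `cone j δ` are those of the identity with row `j` moved to the front. Raising `j` by
-- one exchanges row zero with one other row, hence the alternating sign.
cone-δ : ∀ {m} {F : Matrix (suc m) (suc m) → ℤ} → Alternating F →
         ∀ j → F (cone j δ) ≡ altSign (toℕ j) * F δ
cone-δ {m} {F} alt j = trans (cong-rows cone≗) (sign j)
  where
  open Alternating alt
  open AlternatingProperties alt
  cycle : Fin (suc m) → Matrix (suc m) (suc m)
  cycle j zero    = δ j
  cycle j (suc a) = δ (punchIn j a)
  cone≗ : ∀ i → cone j δ i ≗ cycle j i
  cone≗ zero    _ = refl
  cone≗ (suc a) = punchIn-cases _ j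
    (trans (insertAt-lookup (δ a) j 0ℤ) (sym (δ-≢ (punchInᵢ≢i j a))))
    (λ k → trans (insertAt-punchIn (δ a) j 0ℤ k) (sym (δ-punchIn j a k)))
  flip : ∀ i → F (cycle (suc i)) ≡ - F (cycle (inject₁ i))
  flip i = swap {zero} {suc i} (λ ())
    (≡⇒≗ (cong δ (sym (punchIn-inject₁-self i))))
    (≡⇒≗ (cong δ (punchIn-suc-self i)))
    λ { zero 0≢0 _ → contradiction refl 0≢0
      ; (suc k) _ k≢i → ≡⇒≗ (cong δ (punchIn-suc-≢ i k (k≢i ∘ cong suc))) }
  sign : ∀ j → F (cycle j) ≡ altSign (toℕ j) * F δ
  sign = <-weakInduction _
    (trans (cong-rows (λ { zero _ → refl ; (suc a) _ → refl })) (sym (ℤₚ.*-identityˡ (F δ))))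
    (λ i ih → begin
      F (cycle (suc i))                     ≡⟨ flip i ⟩
      - F (cycle (inject₁ i))               ≡⟨ cong -_ ih ⟩
      - (altSign (toℕ (inject₁ i)) * F δ)   ≡⟨ ℤₚ.neg-distribˡ-* (altSign (toℕ (inject₁ i))) (F δ) ⟩
      - altSign (toℕ (inject₁ i)) * F δ
        ≡⟨ cong (λ t → - altSign t * F δ) (toℕ-inject₁ i) ⟩
      - altSign (toℕ i) * F δ               ≡⟨ cong (_* F δ) (sym (altSign-suc (toℕ i))) ⟩
      altSign (suc (toℕ i)) * F δ           ∎)
    where open ≡-Reasoning

-- Any alternating `F` obeys the Laplace expansion: row zero is expanded in unit vectors, column `j`
-- is cleared by `add-multiples`, and induction applies to the `cone` that remains.
alternating-unique : ∀ m {F : Matrix m m → ℤ} → Alternating F → ∀ M → F M ≡ detℤ m M * F δ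
alternating-unique zero    {F} alt M = trans (Alternating.cong-rows alt (λ ())) (sym (ℤₚ.*-identityˡ (F δ)))
alternating-unique (suc m) {F} alt M = begin
  F M                                    ≡⟨ sym (≔-self M zero (λ _ → refl)) ⟩
  F (M [ zero ≔ M zero ])                ≡⟨ ≔-expand M zero (M zero) ⟩
  sum (λ j → M zero j * F (M [ zero ≔ δ j ]))
    ≡⟨ sum-cong-≗ term ⟩
  sum (λ j → ((altSign (toℕ j) * M zero j) * detℤ m (minor M j)) * F δ)
    ≡⟨ sym (*-distribʳ-sum (F δ) (laplace M)) ⟩
  detℤ (suc m) M * F δ ∎
  where
  open ≡-Reasoning
  open Alternating alt
  open AlternatingProperties alt
  clear : ∀ j → F (M [ zero ≔ δ j ]) ≡ F (cone j (minor M j))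
  clear j = sym (add-multiples zero c refl rows)
    where
    c : Fin (suc m) → ℤ
    c zero    = 0ℤ
    c (suc a) = - M (suc a) j
    cancel : ∀ x → - x * 1ℤ + x ≡ 0ℤ
    cancel = solve-∀
    unchanged : ∀ x y → - x * 0ℤ + y ≡ y
    unchanged = solve-∀
    rows : ∀ i k → cone j (minor M j) i k ≡ c i * δ j k + (M [ zero ≔ δ j ]) i k
    rows zero    k = sym (trans (cong (_+ δ j k) (ℤₚ.*-zeroˡ (δ j k))) (ℤₚ.+-identityˡ _))
    rows (suc a) = punchIn-cases _ j
      (trans (insertAt-lookup (minor M j a) j 0ℤ) (sym
        (trans (cong (λ d → - M (suc a) j * d + M (suc a) j) (δ-refl j)) (cancel (M (suc a) j)))))
      (λ k → trans (insertAt-punchIn (minor M j a) j 0ℤ k) (sym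
        (trans (cong (λ d → - M (suc a) j * d + M (suc a) (punchIn j k))
                  (δ-≢ (punchInᵢ≢i j k ∘ sym)))
               (unchanged (M (suc a) j) _))))
  rearrange : ∀ x d s f → x * (d * (s * f)) ≡ ((s * x) * d) * f
  rearrange = solve-∀
  term : ∀ j → M zero j * F (M [ zero ≔ δ j ]) ≡
               ((altSign (toℕ j) * M zero j) * detℤ m (minor M j)) * F δ
  term j = begin
    M zero j * F (M [ zero ≔ δ j ])            ≡⟨ cong (M zero j *_) (clear j) ⟩
    M zero j * F (cone j (minor M j))
      ≡⟨ cong (M zero j *_) (alternating-unique m (cone-alternating alt j) (minor M j)) ⟩
    M zero j * (detℤ m (minor M j) * F (cone j δ))
      ≡⟨ cong (λ x → M zero j * (detℤ m (minor M j) * x)) (cone-δ alt j) ⟩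
    M zero j * (detℤ m (minor M j) * (altSign (toℕ j) * F δ))
      ≡⟨ rearrange (M zero j) (detℤ m (minor M j)) (altSign (toℕ j)) (F δ) ⟩
    ((altSign (toℕ j) * M zero j) * detℤ m (minor M j)) * F δ ∎


-- Evaluation of polynomials

eval : ℤ → Poly → ℤ
eval x []      = 0ℤ
eval x (c ∷ p) = c + x * eval x p

eval-+ : ∀ x p q → eval x (p +ₚ q) ≡ eval x p + eval x q
eval-+ x []      q       = sym (ℤₚ.+-identityˡ (eval x q))
eval-+ x (a ∷ p) []      = sym (ℤₚ.+-identityʳ (eval x (a ∷ p)))
eval-+ x (a ∷ p) (b ∷ q) =
  trans (cong (λ y → (a + b) + x * y) (eval-+ x p q)) (rearrange a b x (eval x p) (eval x q))
  where
  rearrange : ∀ a b x p q → (a + b) + x * (p + q) ≡ (a + x * p) + (b + x * q)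
  rearrange = solve-∀

eval-scale : ∀ x a p → eval x (map (a *_) p) ≡ a * eval x p
eval-scale x a []      = sym (ℤₚ.*-zeroʳ a)
eval-scale x a (b ∷ p) =
  trans (cong (λ y → a * b + x * y) (eval-scale x a p)) (rearrange a b x (eval x p))
  where
  rearrange : ∀ a b x p → a * b + x * (a * p) ≡ a * (b + x * p)
  rearrange = solve-∀

eval-* : ∀ x p q → eval x (p *ₚ q) ≡ eval x p * eval x q
eval-* x []      q = sym (ℤₚ.*-zeroˡ (eval x q))
eval-* x (a ∷ p) q = begin
  eval x (map (a *_) q +ₚ (0ℤ ∷ (p *ₚ q)))
    ≡⟨ eval-+ x (map (a *_) q) (0ℤ ∷ (p *ₚ q)) ⟩
  eval x (map (a *_) q) + (0ℤ + x * eval x (p *ₚ q))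
    ≡⟨ cong₂ (λ y z → y + (0ℤ + x * z)) (eval-scale x a q) (eval-* x p q) ⟩
  a * eval x q + (0ℤ + x * (eval x p * eval x q))
    ≡⟨ rearrange a x (eval x p) (eval x q) ⟩
  (a + x * eval x p) * eval x q ∎
  where
  open ≡-Reasoning
  rearrange : ∀ a x p q → a * q + (0ℤ + x * (p * q)) ≡ (a + x * p) * q
  rearrange = solve-∀

eval-sum : ∀ x {n} (f : Fin n → Poly) → eval x (foldr _+ₚ_ [] (tabulate f)) ≡ sum (eval x ∘ f)
eval-sum x {zero}  f = refl
eval-sum x {suc n} f = trans (eval-+ x (f zero) _) (cong (λ y → eval x (f zero) + y) (eval-sum x (f ∘ suc)))

eval-constant : ∀ x c → eval x (c ∷ []) ≡ c
eval-constant x c = trans (cong (λ y → c + y) (ℤₚ.*-zeroʳ x)) (ℤₚ.+-identityʳ c)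

eval-det : ∀ x n (M : Fin n → Fin n → Poly) → eval x (det n M) ≡ detℤ n (λ i j → eval x (M i j))
eval-det x zero    M = eval-constant x 1ℤ
eval-det x (suc n) M = begin
  eval x (foldr _+ₚ_ [] (map term (allFin (suc n))))
    ≡⟨ cong (eval x ∘ foldr _+ₚ_ []) (map-tabulate id term) ⟩
  eval x (foldr _+ₚ_ [] (tabulate term))   ≡⟨ eval-sum x term ⟩
  sum (eval x ∘ term)                      ≡⟨ sum-cong-≗ eval-term ⟩
  detℤ (suc n) (λ i j → eval x (M i j))    ∎
  where
  open ≡-Reasoning
  rest : Fin (suc n) → Fin n → Fin n → Poly
  rest j a b = M (suc a) (punchIn j b)
  term : Fin (suc n) → Poly
  term j = ((altSign (toℕ j) ∷ []) *ₚ M zero j) *ₚ det n (rest j)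
  eval-term : ∀ j → eval x (term j) ≡ laplace (λ i j → eval x (M i j)) j
  eval-term j = begin
    eval x (term j)
      ≡⟨ eval-* x ((altSign (toℕ j) ∷ []) *ₚ M zero j) (det n (rest j)) ⟩
    eval x ((altSign (toℕ j) ∷ []) *ₚ M zero j) * eval x (det n (rest j))
      ≡⟨ cong₂ _*_ (eval-* x (altSign (toℕ j) ∷ []) (M zero j)) (eval-det x n (rest j)) ⟩
    (eval x (altSign (toℕ j) ∷ []) * eval x (M zero j)) * detℤ n (λ a b → eval x (rest j a b))
      ≡⟨ cong (λ y → (y * eval x (M zero j)) * detℤ n (λ a b → eval x (rest j a b)))
           (eval-constant x (altSign (toℕ j))) ⟩
    laplace (λ i j → eval x (M i j)) j ∎

-- Vanishing order at 0 of polynomial functions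

-- f is a polynomial function divisible by x ^ m
Vanishes : ℕ → (ℤ → ℤ) → Set
Vanishes m f = ∃ λ q → ∀ x → f x ≡ x ^ m * eval x q

vanishes-cong : ∀ m {f g} → (∀ x → f x ≡ g x) → Vanishes m g → Vanishes m f
vanishes-cong m f≗g (q , eq) = q , λ x → trans (f≗g x) (eq x)

vanishes-eval : ∀ p → Vanishes 0 (λ x → eval x p)
vanishes-eval p = p , λ x → sym (ℤₚ.*-identityˡ (eval x p))

vanishes-scale : ∀ m {f} c → Vanishes m f → Vanishes m (λ x → c * f x)
vanishes-scale m c (q , eq) = map (c *_) q , λ x →
  trans (cong (c *_) (eq x)) (trans (rearrange c (x ^ m) (eval x q))
        (cong (x ^ m *_) (sym (eval-scale x c q))))
  where
  rearrange : ∀ c y z → c * (y * z) ≡ y * (c * z)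
  rearrange = solve-∀

zeroMult-vanishes : ∀ m p → m ≤ zeroMult p → Vanishes m (λ x → eval x p)
zeroMult-vanishes zero    p        _    = vanishes-eval p
zeroMult-vanishes (suc m) (c ∷ cs) m<z with c ℤ.≟ 0ℤ
... | yes refl with zeroMult-vanishes m cs (ℕₚ.≤-pred m<z)
...   | q , eq = q , λ x → trans (ℤₚ.+-identityˡ (x * eval x cs))
                   (trans (cong (x *_) (eq x)) (sym (ℤₚ.*-assoc x (x ^ m) (eval x q))))

eval-tail : ∀ q → ∃ λ r → ∀ x → eval x q ≡ eval 0ℤ q + x * eval x r
eval-tail []      = [] , λ x → sym (trans (ℤₚ.+-identityˡ (x * 0ℤ)) (ℤₚ.*-zeroʳ x))
eval-tail (c ∷ q) = q , λ x → cong (_+ x * eval x q)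
  (sym (trans (cong (λ y → c + y) (ℤₚ.*-zeroˡ (eval 0ℤ q))) (ℤₚ.+-identityʳ c)))

vanishes-suc : ∀ m {f} (V : Vanishes m f) → eval 0ℤ (proj₁ V) ≡ 0ℤ → Vanishes (suc m) f
vanishes-suc m {f} (q , eq) q₀≡0 with eval-tail q
... | r , eq′ = r , λ x → begin
  f x                                    ≡⟨ eq x ⟩
  x ^ m * eval x q                       ≡⟨ cong (x ^ m *_) (eq′ x) ⟩
  x ^ m * (eval 0ℤ q + x * eval x r)     ≡⟨ cong (λ y → x ^ m * (y + x * eval x r)) q₀≡0 ⟩
  x ^ m * (0ℤ + x * eval x r)            ≡⟨ rearrange x (x ^ m) (eval x r) ⟩
  x * x ^ m * eval x r                   ∎
  where
  open ≡-Reasoning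
  rearrange : ∀ x y z → y * (0ℤ + x * z) ≡ x * y * z
  rearrange = solve-∀

-- Positivity of squares and the drop in vanishing order

square-ℕ : ∀ c → ∃ λ k → (c * c ≡ + k) × (k ≡ 0 → c ≡ 0ℤ)
square-ℕ (+ zero)   = 0 , refl , λ _ → refl
square-ℕ (+ suc n)  = suc n ℕ.* suc n , refl , λ ()
square-ℕ (-[1+ n ]) = suc n ℕ.* suc n , refl , λ ()

-- Positivity is essential to the multiplicity bound: over the complex numbers a symmetric matrix
-- can be nilpotent of size 2 with nonzero diagonal, and one deletion then lowers the multiplicity
-- by two.
sum-squares-ℕ : ∀ {n} (c : Fin n → ℤ) →
  ∃ λ k → (sum (λ i → c i * c i) ≡ + k) × (k ≡ 0 → ∀ i → c i ≡ 0ℤ)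
sum-squares-ℕ {zero}  c = 0 , refl , λ _ ()
sum-squares-ℕ {suc n} c with square-ℕ (c zero) | sum-squares-ℕ (c ∘ suc)
... | k , eq , zero-k | l , eq′ , zero-l = k ℕ.+ l , cong₂ _+_ eq eq′ , λ k+l≡0 →
  λ { zero    → zero-k (ℕₚ.m+n≡0⇒m≡0 k k+l≡0)
    ; (suc i) → zero-l (ℕₚ.m+n≡0⇒n≡0 k k+l≡0) i }

-- Replaces the argument that an integer divisible by every nonzero `x` is 0: a single `x`, the
-- successor of the number itself, is enough.
multiple-of-successor : ∀ k t → + k ≡ + suc k * t → k ≡ 0
multiple-of-successor k t eq = helper ∣ t ∣ (trans (cong ∣_∣ eq) (ℤₚ.abs-* (+ suc k) t))
  where
  helper : ∀ u → k ≡ suc k ℕ.* u → k ≡ 0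
  helper zero    e = trans e (ℕₚ.*-zeroʳ (suc k))
  helper (suc u) e = contradiction (subst (suc k ≤_) (sym e) (ℕₚ.m≤m*n (suc k) (suc u))) ℕₚ.1+n≰n

^-≢0 : ∀ x m → x ≢ 0ℤ → x ^ m ≢ 0ℤ
^-≢0 x zero    x≢0 ()
^-≢0 x (suc m) x≢0 eq with ℤₚ.i*j≡0⇒i≡0∨j≡0 x eq
... | inj₁ x≡0  = x≢0 x≡0
... | inj₂ xᵐ≡0 = ^-≢0 x m x≢0 xᵐ≡0

-- If all V w vanish to order j < m, divide the identity by x ^ (2j + 1): then x divides
-- 2 Σ (Q w 0)², where V w = x ^ j Q w, for every x ≠ 0. So all Q w 0 are zero.
order-drop : ∀ {n} (V : Fin n → ℤ → ℤ) (φ : ℤ → ℤ) v m →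
  (∀ w → Vanishes 0 (V w)) → Vanishes (suc m) φ →
  (∀ x → φ x * V v (- x) + - (φ (- x) * V v x) ≡ (x + x) * sum (λ w → V w x * V w (- x))) →
  ∀ w → Vanishes m (V w)
order-drop {n} V φ v m V₀ (p , φ≡) identity = go m ℕₚ.≤-refl
  where
  go : ∀ j → j ≤ m → ∀ w → Vanishes j (V w)
  go zero    _   = V₀
  go (suc j) j<m w = vanishes-suc j (IH w) (Q₀≡0 w)
    where
    open ≡-Reasoning
    IH : ∀ w → Vanishes j (V w)
    IH = go j (ℕₚ.<⇒≤ j<m)
    Q : Fin n → ℤ → ℤ
    Q w x = eval x (proj₁ (IH w))
    V≡ : ∀ w x → V w x ≡ x ^ j * Q w x
    V≡ w = proj₂ (IH w)
    -- `suc m` equals `2 + j + d`. Of the factors of `φ x`, `x ^ j` and one `x` are cancelled in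
    -- `divided`; the second `x` survives as the factor of `K x`.
    d : ℕ
    d = m ∸ suc j
    g : ℤ → ℤ
    g x = x ^ d * eval x p
    φ-factor : ∀ x → φ x ≡ x ^ j * (x * x) * g x
    φ-factor x = begin
      φ x                              ≡⟨ φ≡ x ⟩
      x ^ suc m * eval x p
        ≡⟨ cong (λ e → x ^ suc e * eval x p) (sym (ℕₚ.m+[n∸m]≡n j<m)) ⟩
      x ^ (2 ℕ.+ (j ℕ.+ d)) * eval x p
        ≡⟨ cong (λ y → x * (x * y) * eval x p) (ℤₚ.^-distribˡ-+-* x j d) ⟩
      x * (x * (x ^ j * x ^ d)) * eval x p ≡⟨ rearrange x (x ^ j) (x ^ d) (eval x p) ⟩
      x ^ j * (x * x) * g x            ∎
      where
      rearrange : ∀ x a b e → x * (x * (a * b)) * e ≡ a * (x * x) * (b * e)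
      rearrange = solve-∀
    c : Fin n → ℤ
    c w = Q w 0ℤ
    R : Fin n → ℤ → ℤ
    R w x = eval x (proj₁ (eval-tail (proj₁ (IH w))))
    Q-tail : ∀ w x → Q w x ≡ c w + x * R w x
    Q-tail w = proj₂ (eval-tail (proj₁ (IH w)))
    -- The quotient of `Q w x * Q w (- x) - c w * c w` by `x`.
    r : Fin n → ℤ → ℤ
    r w x = R w x * c w + - (c w * R w (- x)) + - (x * (R w x * R w (- x)))
    QQ : ∀ w x → Q w x * Q w (- x) ≡ x * r w x + c w * c w
    QQ w x = trans (cong₂ _*_ (Q-tail w x) (Q-tail w (- x)))
                   (rearrange (c w) x (R w x) (R w (- x)))
      where
      rearrange : ∀ c x a b → (c + x * a) * (c + - x * b) ≡
                  x * (a * c + - (c * b) + - (x * (a * b))) + c * c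
      rearrange = solve-∀
    K : ℤ → ℤ
    K x = g x * Q v (- x) + - (g (- x) * Q v x)
    divided : ∀ x → x ≢ 0ℤ → x * K x ≡ + 2 * sum (λ w → Q w x * Q w (- x))
    divided x x≢0 = ℤₚ.*-cancelˡ-≡ (x ^ j * ((- x) ^ j * x)) (x * K x) _ {{ℤ.≢-nonZero nz}} (begin
      (a * (b * x)) * (x * K x)
        ≡⟨ left a b x (g x) (g (- x)) (Q v x) (Q v (- x)) ⟩
      a * (x * x) * g x * (b * Q v (- x)) + - (b * (- x * - x) * g (- x) * (a * Q v x))
        ≡⟨ sym (cong₂ (λ y z → y + - z)
             (cong₂ _*_ (φ-factor x) (V≡ v (- x))) (cong₂ _*_ (φ-factor (- x)) (V≡ v x))) ⟩
      φ x * V v (- x) + - (φ (- x) * V v x) ≡⟨ identity x ⟩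
      (x + x) * sum (λ w → V w x * V w (- x))
        ≡⟨ cong ((x + x) *_) (trans (sum-cong-≗ (λ w → trans (cong₂ _*_ (V≡ w x) (V≡ w (- x)))
             (regroup a b (Q w x) (Q w (- x))))) (sym (*-distribˡ-sum (a * b) (λ w → Q w x * Q w (- x))))) ⟩
      (x + x) * ((a * b) * S)
        ≡⟨ right a b x S ⟩
      (a * (b * x)) * (+ 2 * S) ∎)
      where
      a b S : ℤ
      a = x ^ j
      b = (- x) ^ j
      S = sum (λ w → Q w x * Q w (- x))
      -x≢0 : - x ≢ 0ℤ
      -x≢0 eq = x≢0 (trans (sym (ℤₚ.neg-involutive x)) (cong -_ eq))
      nz : a * (b * x) ≢ 0ℤ
      nz eq with ℤₚ.i*j≡0⇒i≡0∨j≡0 a eq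
      ... | inj₁ e = ^-≢0 x j x≢0 e
      ... | inj₂ e with ℤₚ.i*j≡0⇒i≡0∨j≡0 b e
      ...   | inj₁ e′ = ^-≢0 (- x) j -x≢0 e′
      ...   | inj₂ e′ = x≢0 e′
      left : ∀ a b x g g′ q q′ → (a * (b * x)) * (x * (g * q′ + - (g′ * q))) ≡
             a * (x * x) * g * (b * q′) + - (b * (- x * - x) * g′ * (a * q))
      left = solve-∀
      regroup : ∀ a b q q′ → (a * q) * (b * q′) ≡ (a * b) * (q * q′)
      regroup = solve-∀
      right : ∀ a b x s → (x + x) * ((a * b) * s) ≡ (a * (b * x)) * (+ 2 * s)
      right = solve-∀
    divides : ∀ x → x ≢ 0ℤ → + 2 * sum (λ w → c w * c w) ≡ x * (K x + - (+ 2 * sum (λ w → r w x)))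
    divides x x≢0 = isolate _ _ x _ (begin
      x * K x                                      ≡⟨ divided x x≢0 ⟩
      + 2 * sum (λ w → Q w x * Q w (- x))          ≡⟨ cong (+ 2 *_) (sum-cong-≗ (λ w → QQ w x)) ⟩
      + 2 * sum (λ w → x * r w x + c w * c w)
        ≡⟨ cong (+ 2 *_) (sum-linear x (λ w → r w x) (λ w → c w * c w)) ⟩
      + 2 * (x * sum (λ w → r w x) + sum (λ w → c w * c w)) ∎)
      where
      isolate : ∀ k s x c → x * k ≡ + 2 * (x * s + c) → + 2 * c ≡ x * (k + - (+ 2 * s))
      isolate k s x c eq = begin
        + 2 * c                                         ≡⟨ shift s x c ⟩
        + 2 * (x * s + c) + - (x * (+ 2 * s))           ≡⟨ cong (_+ - (x * (+ 2 * s))) (sym eq) ⟩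
        x * k + - (x * (+ 2 * s))                       ≡⟨ collect k s x ⟩
        x * (k + - (+ 2 * s))                           ∎
        where
        shift : ∀ s x c → + 2 * c ≡ + 2 * (x * s + c) + - (x * (+ 2 * s))
        shift = solve-∀
        collect : ∀ k s x → x * k + - (x * (+ 2 * s)) ≡ x * (k + - (+ 2 * s))
        collect = solve-∀
    Q₀≡0 : ∀ w → c w ≡ 0ℤ
    Q₀≡0 with sum-squares-ℕ c
    -- `k + (k + 0)` is the unfolded `2 * k`. With `x = 2k + 1`, `divides` makes `2k` a multiple of
    -- `2k + 1`, so `k` is 0.
    ... | k , eq , zero-k = zero-k (ℕₚ.m+n≡0⇒m≡0 k
      (multiple-of-successor (k ℕ.+ (k ℕ.+ 0)) _
        (trans (ℤₚ.pos-* 2 k) (trans (cong (+ 2 *_) (sym eq)) (divides (+ suc (k ℕ.+ (k ℕ.+ 0))) (λ ()))))))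

-- Symmetric pencils B + x diag(eᵢ²), and their principal subpencils

-- The weights are 1 on present indices and 0 on deleted ones. They are written as squares so that
-- each term of the Christoffel-Darboux sum is a product of two values of one function `e w * u w`.
pencil : ∀ {n} → Matrix n n → (Fin n → ℤ) → ℤ → Matrix n n
pencil B e x i j = B i j + x * ((e i * e i) * δ i j)

-- Deleting v means replacing its row and column by those of the identity matrix.
delete : ∀ {n} → Fin n → Matrix n n → Matrix n n
delete v B i j = if does (v ≟ i) ∨ does (v ≟ j) then δ i j else B i j

-- Weight 0 keeps `x` off the diagonal entry of a deleted index. That entry stays 1, so the
-- determinant is that of the remaining principal pencil.
deleteWeight : ∀ {n} → Fin n → (Fin n → ℤ) → Fin n → ℤ
deleteWeight v e i = if does (v ≟ i) then 0ℤ else e i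

δ-sym : ∀ {n} (i j : Fin n) → δ i j ≡ δ j i
δ-sym i j with i ≟ j
... | yes refl = sym (δ-refl i)
... | no i≢j   = sym (δ-≢ (i≢j ∘ sym))

Symmetric : ∀ {n} → Matrix n n → Set
Symmetric B = ∀ i j → B i j ≡ B j i

delete-symmetric : ∀ {n} v {B : Matrix n n} → Symmetric B → Symmetric (delete v B)
delete-symmetric v B-sym i j with v ≟ i | v ≟ j
... | yes _ | yes _ = δ-sym i j
... | yes _ | no _  = δ-sym i j
... | no _  | yes _ = δ-sym i j
... | no _  | no _  = B-sym i j

-- With linear polynomials as entries, `det` exhibits each cofactor as a polynomial function; this
-- is the order 0 from which `order-drop` starts.
detℤ-pencil-polynomial : ∀ {n} (B : Matrix n n) e v r →
  Vanishes 0 (λ x → detℤ n (pencil B e x [ v ≔ r ]))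
detℤ-pencil-polynomial {n} B e v r =
  vanishes-cong 0 (λ x → sym (trans (eval-det x n entries) (detℤ-cong n (eval-entries x))))
                (vanishes-eval (det n entries))
  where
  linear : Fin n → Fin n → Poly
  linear i j = B i j ∷ (e i * e i) * δ i j ∷ []
  entries : Fin n → Fin n → Poly
  entries = updateAt linear v (const (λ j → r j ∷ []))
  eval-entries : ∀ x i j → eval x (entries i j) ≡ (pencil B e x [ v ≔ r ]) i j
  eval-entries x i j with i ≟ v
  ... | yes refl = begin
    eval x (entries v j)            ≡⟨ cong (λ row → eval x (row j)) (updateAt-updates v linear) ⟩
    eval x (r j ∷ [])               ≡⟨ eval-constant x (r j) ⟩
    r j                             ≡⟨ cong (λ row → row j) (sym (≔-at (pencil B e x) v r)) ⟩
    (pencil B e x [ v ≔ r ]) v j    ∎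
    where open ≡-Reasoning
  ... | no i≢v = begin
    eval x (entries i j)            ≡⟨ cong (λ row → eval x (row j)) (updateAt-minimal i v linear i≢v) ⟩
    B i j + x * eval x ((e i * e i) * δ i j ∷ [])
      ≡⟨ cong (λ y → B i j + x * y) (eval-constant x ((e i * e i) * δ i j)) ⟩
    pencil B e x i j                ≡⟨ cong (λ row → row j) (sym (≔-off (pencil B e x) r i≢v)) ⟩
    (pencil B e x [ v ≔ r ]) i j    ∎
    where open ≡-Reasoning

-- Adjugate rows and the deletion of one index

-- Row v of the adjugate of M.
cofactor : ∀ {n} → Matrix n n → Fin n → Fin n → ℤ
cofactor {n} M v w = detℤ n (M [ v ≔ δ w ])

-- The left side expands the determinant of `M` with row `i` copied into row `v`: this is `M` itself
-- when `i` is `v`, and a matrix with two equal rows otherwise.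
cofactor-solves : ∀ {n} (M : Matrix n n) v i →
  sum (λ j → M i j * cofactor M v j) ≡ detℤ n M * δ v i
cofactor-solves {n} M v i = trans (sym (≔-expand M v (M i))) value
  where
  open AlternatingProperties (detℤ-alternating n)
  value : detℤ n (M [ v ≔ M i ]) ≡ detℤ n M * δ v i
  value with v ≟ i
  ... | yes refl = trans (≔-self M v (λ _ → refl)) (sym (ℤₚ.*-identityʳ (detℤ n M)))
  ... | no v≢i   = trans (≔-duplicate M v≢i) (sym (ℤₚ.*-zeroʳ (detℤ n M)))

-- With u z the cofactor row at z, both terms on the left are values of the bilinear form
-- u(y)ᵀ (B + z diag(eᵢ²)) u(x), at z = x and z = y.
christoffel-darboux : ∀ {n} (B : Matrix n n) e → Symmetric B → ∀ v x y →
  detℤ n (pencil B e x) * cofactor (pencil B e y) v v +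
    - (detℤ n (pencil B e y) * cofactor (pencil B e x) v v) ≡
  (x + - y) * sum (λ w → (e w * cofactor (pencil B e x) v w) * (e w * cofactor (pencil B e y) v w))
christoffel-darboux {n} B e B-sym v x y = begin
  φ x * u y v + - (φ y * u x v)
    ≡⟨ sym (cong₂ (λ p q → p + - q) (form-x x y) (trans transposed (form-x y x))) ⟩
  sum (λ i → u y i * sum (λ j → P x i j * u x j)) +
    - sum (λ i → u y i * sum (λ j → P y i j * u x j))
    ≡⟨ cong (λ z → sum (λ i → u y i * sum (λ j → P x i j * u x j)) + z)
         (sym (sum-neg (λ i → u y i * sum (λ j → P y i j * u x j)))) ⟩
  sum (λ i → u y i * sum (λ j → P x i j * u x j)) +
    sum (λ i → - (u y i * sum (λ j → P y i j * u x j)))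
    ≡⟨ sym (∑-distrib-+ (λ i → u y i * sum (λ j → P x i j * u x j)) _) ⟩
  sum (λ i → u y i * sum (λ j → P x i j * u x j) + - (u y i * sum (λ j → P y i j * u x j)))
    ≡⟨ sum-cong-≗ term ⟩
  sum (λ i → (x + - y) * ((e i * u x i) * (e i * u y i)))
    ≡⟨ sym (*-distribˡ-sum (x + - y) (λ i → (e i * u x i) * (e i * u y i))) ⟩
  (x + - y) * sum (λ i → (e i * u x i) * (e i * u y i)) ∎
  where
  open ≡-Reasoning
  P : ℤ → Matrix n n
  P = pencil B e
  φ : ℤ → ℤ
  φ z = detℤ n (P z)
  u : ℤ → Fin n → ℤ
  u z = cofactor (P z) v
  P-sym : ∀ z → Symmetric (P z)
  P-sym z i j with i ≟ j
  ... | yes refl = cong (λ d → B i i + z * ((e i * e i) * d)) (sym (δ-refl i))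
  ... | no i≢j   = begin
    B i j + z * ((e i * e i) * 0ℤ)  ≡⟨ no-diagonal (B i j) z (e i * e i) ⟩
    B i j                           ≡⟨ B-sym i j ⟩
    B j i                           ≡⟨ sym (no-diagonal (B j i) z (e j * e j)) ⟩
    B j i + z * ((e j * e j) * 0ℤ)
      ≡⟨ cong (λ d → B j i + z * ((e j * e j) * d)) (sym (δ-≢ (i≢j ∘ sym))) ⟩
    P z j i                         ∎
    where
    no-diagonal : ∀ b z c → b + z * (c * 0ℤ) ≡ b
    no-diagonal = solve-∀
  form-x : ∀ x y → sum (λ i → u y i * sum (λ j → P x i j * u x j)) ≡ φ x * u y v
  form-x x y = begin
    sum (λ i → u y i * sum (λ j → P x i j * u x j))
      ≡⟨ sum-cong-≗ (λ i → trans (cong (u y i *_) (cofactor-solves (P x) v i))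
           (trans (rearrange (u y i) (φ x) (δ v i)) (cong (λ d → φ x * (u y i * d)) (δ-sym v i)))) ⟩
    sum (λ i → φ x * (u y i * δ i v))   ≡⟨ sym (*-distribˡ-sum (φ x) (λ i → u y i * δ i v)) ⟩
    φ x * sum (λ i → u y i * δ i v)     ≡⟨ cong (φ x *_) (sum-δ (u y) v) ⟩
    φ x * u y v                         ∎
    where
    rearrange : ∀ a b d → a * (b * d) ≡ b * (a * d)
    rearrange = solve-∀
  -- Here symmetry of the pencil is used: the bilinear form may be read from either side.
  transposed : sum (λ i → u y i * sum (λ j → P y i j * u x j)) ≡
               sum (λ i → u x i * sum (λ j → P y i j * u y j))
  transposed = begin
    sum (λ i → u y i * sum (λ j → P y i j * u x j))
      ≡⟨ sum-cong-≗ (λ i → *-distribˡ-sum (u y i) (λ j → P y i j * u x j)) ⟩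
    sum (λ i → sum (λ j → u y i * (P y i j * u x j)))
      ≡⟨ ∑-comm (λ i j → u y i * (P y i j * u x j)) ⟩
    sum (λ j → sum (λ i → u y i * (P y i j * u x j)))
      ≡⟨ sum-cong-≗ (λ j → sum-cong-≗ (λ i →
           trans (cong (λ p → u y i * (p * u x j)) (P-sym y i j)) (rearrange (u y i) (P y j i) (u x j)))) ⟩
    sum (λ j → sum (λ i → u x j * (P y j i * u y i)))
      ≡⟨ sum-cong-≗ (λ j → sym (*-distribˡ-sum (u x j) (λ i → P y j i * u y i))) ⟩
    sum (λ j → u x j * sum (λ i → P y j i * u y i)) ∎
    where
    rearrange : ∀ a p b → a * (p * b) ≡ b * (p * a)
    rearrange = solve-∀
  term : ∀ i → u y i * sum (λ j → P x i j * u x j) + - (u y i * sum (λ j → P y i j * u x j)) ≡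
               (x + - y) * ((e i * u x i) * (e i * u y i))
  term i = begin
    u y i * sum (λ j → P x i j * u x j) + - (u y i * sum (λ j → P y i j * u x j))
      ≡⟨ cong₂ (λ p q → u y i * p + - (u y i * q)) (row x) (row y) ⟩
    u y i * (x * (e i * e i * u x i) + b) + - (u y i * (y * (e i * e i * u x i) + b))
      ≡⟨ rearrange (u y i) (u x i) x y (e i) b ⟩
    (x + - y) * ((e i * u x i) * (e i * u y i)) ∎
    where
    b : ℤ
    b = sum (λ j → B i j * u x j)
    rearrange : ∀ a c x y e b → a * (x * (e * e * c) + b) + - (a * (y * (e * e * c) + b)) ≡
                (x + - y) * ((e * c) * (e * a))
    rearrange = solve-∀
    split : ∀ b z c d a → (b + z * (c * d)) * a ≡ z * (c * (a * d)) + b * a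
    split = solve-∀
    row : ∀ z → sum (λ j → P z i j * u x j) ≡ z * (e i * e i * u x i) + b
    row z = begin
      sum (λ j → P z i j * u x j)
        ≡⟨ sum-cong-≗ (λ j → trans (split (B i j) z (e i * e i) (δ i j) (u x j))
             (cong (λ d → z * (e i * e i * (u x j * d)) + B i j * u x j) (δ-sym i j))) ⟩
      sum (λ j → z * (e i * e i * (u x j * δ j i)) + B i j * u x j)
        ≡⟨ sum-linear z (λ j → e i * e i * (u x j * δ j i)) (λ j → B i j * u x j) ⟩
      z * sum (λ j → e i * e i * (u x j * δ j i)) + b
        ≡⟨ cong (λ s → z * s + b) (trans (sym (*-distribˡ-sum (e i * e i) (λ j → u x j * δ j i)))
             (cong (e i * e i *_) (sum-δ (u x) i))) ⟩
      z * (e i * e i * u x i) + b ∎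

-- Row `v` on the left is already `δ v`; subtracting `P i v` times it from each other row `i` clears
-- column `v`.
cofactor-pencil : ∀ {n} (B : Matrix n n) e v x →
  cofactor (pencil B e x) v v ≡ detℤ n (pencil (delete v B) (deleteWeight v e) x)
cofactor-pencil {n} B e v x = sym (add-multiples v c c-v rows)
  where
  open AlternatingProperties (detℤ-alternating n)
  P : Matrix n n
  P = pencil B e x
  c : Fin n → ℤ
  c i = if does (v ≟ i) then 0ℤ else - P i v
  c-v : c v ≡ 0ℤ
  c-v with v ≟ v
  ... | yes _  = refl
  ... | no v≢v = contradiction refl v≢v
  identity-row : ∀ d x → d + x * (0ℤ * 0ℤ * d) ≡ 0ℤ * d + d
  identity-row = solve-∀
  cleared : ∀ p x e → 0ℤ + x * (e * e * 0ℤ) ≡ - p * 1ℤ + p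
  cleared = solve-∀
  unchanged : ∀ p q → p ≡ - q * 0ℤ + p
  unchanged = solve-∀
  rows : ∀ i k → pencil (delete v B) (deleteWeight v e) x i k ≡
                 c i * (P [ v ≔ δ v ]) v k + (P [ v ≔ δ v ]) i k
  rows i k with v ≟ i
  ... | yes refl = trans (identity-row (δ v k) x)
    (cong (λ row → 0ℤ * row k + row k) (sym (≔-at P v (δ v))))
  ... | no v≢i with v ≟ k
  ...   | yes refl = begin
    δ i v + x * (e i * e i * δ i v)
      ≡⟨ cong (λ d → d + x * (e i * e i * d)) (δ-≢ (v≢i ∘ sym)) ⟩
    0ℤ + x * (e i * e i * 0ℤ)    ≡⟨ cleared (P i v) x (e i) ⟩
    - P i v * 1ℤ + P i v
      ≡⟨ cong₂ (λ d row → - P i v * d + row v)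
           (sym (trans (cong (λ row → row v) (≔-at P v (δ v))) (δ-refl v)))
           (sym (≔-off P (δ v) (v≢i ∘ sym))) ⟩
    - P i v * (P [ v ≔ δ v ]) v v + (P [ v ≔ δ v ]) i v ∎
    where open ≡-Reasoning
  ...   | no v≢k = begin
    P i k                   ≡⟨ unchanged (P i k) (P i v) ⟩
    - P i v * 0ℤ + P i k
      ≡⟨ cong₂ (λ d row → - P i v * d + row k)
           (sym (trans (cong (λ row → row k) (≔-at P v (δ v))) (δ-≢ v≢k)))
           (sym (≔-off P (δ v) (v≢i ∘ sym))) ⟩
    - P i v * (P [ v ≔ δ v ]) v k + (P [ v ≔ δ v ]) i k ∎
    where open ≡-Reasoning

-- The identity is taken at `y = - x`. The hypothesis `e v ≡ 1ℤ`, that `v` is not yet deleted,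
-- identifies `V v` with the determinant after the deletion.
interlacing : ∀ {n} m (B : Matrix n n) e → Symmetric B → ∀ v → e v ≡ 1ℤ →
  Vanishes (suc m) (λ x → detℤ n (pencil B e x)) →
  Vanishes m (λ x → detℤ n (pencil (delete v B) (deleteWeight v e) x))
interlacing {n} m B e B-sym v ev≡1 φ-vanishes =
  vanishes-cong m (λ x → trans (sym (cofactor-pencil B e v x)) (sym (V-v x)))
    (order-drop V φ v m
      (λ w → vanishes-scale 0 (e w) (detℤ-pencil-polynomial B e v (δ w)))
      φ-vanishes identity v)
  where
  open ≡-Reasoning
  φ : ℤ → ℤ
  φ x = detℤ n (pencil B e x)
  V : Fin n → ℤ → ℤ
  V w x = e w * cofactor (pencil B e x) v w
  V-v : ∀ x → V v x ≡ cofactor (pencil B e x) v v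
  V-v x = trans (cong (_* cofactor (pencil B e x) v v) ev≡1) (ℤₚ.*-identityˡ _)
  identity : ∀ x → φ x * V v (- x) + - (φ (- x) * V v x) ≡ (x + x) * sum (λ w → V w x * V w (- x))
  identity x = begin
    φ x * V v (- x) + - (φ (- x) * V v x)
      ≡⟨ cong₂ (λ p q → φ x * p + - (φ (- x) * q)) (V-v (- x)) (V-v x) ⟩
    φ x * cofactor (pencil B e (- x)) v v + - (φ (- x) * cofactor (pencil B e x) v v)
      ≡⟨ christoffel-darboux B e B-sym v x (- x) ⟩
    (x + - - x) * sum (λ w → V w x * V w (- x))
      ≡⟨ cong (λ y → (x + y) * sum (λ w → V w x * V w (- x))) (ℤₚ.neg-involutive x) ⟩
    (x + x) * sum (λ w → V w x * V w (- x)) ∎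

-- Deletion of several indices

deleteAll : ∀ {n} → List (Fin n) → Matrix n n → Matrix n n
deleteAll []      B = B
deleteAll (v ∷ L) B = delete v (deleteAll L B)

deleteWeights : ∀ {n} → List (Fin n) → Fin n → ℤ
deleteWeights []      = const 1ℤ
deleteWeights (v ∷ L) = deleteWeight v (deleteWeights L)

deleteAll-symmetric : ∀ {n} L {B : Matrix n n} → Symmetric B → Symmetric (deleteAll L B)
deleteAll-symmetric []      B-sym = B-sym
deleteAll-symmetric (v ∷ L) {B} B-sym = delete-symmetric v {deleteAll L B} (deleteAll-symmetric L B-sym)

deleteWeights-∉ : ∀ {n} L {i : Fin n} → i ∉ L → deleteWeights L i ≡ 1ℤ
deleteWeights-∉ []      i∉L = refl
deleteWeights-∉ (v ∷ L) {i} i∉L with v ≟ i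
... | yes refl = contradiction (here refl) i∉L
... | no _     = deleteWeights-∉ L (i∉L ∘ there)

deleteAll-∉ : ∀ {n} L (B : Matrix n n) {i j} → i ∉ L → j ∉ L → deleteAll L B i j ≡ B i j
deleteAll-∉ []      B i∉L j∉L = refl
deleteAll-∉ (v ∷ L) B {i} {j} i∉L j∉L with v ≟ i | v ≟ j
... | yes refl | _        = contradiction (here refl) i∉L
... | no _     | yes refl = contradiction (here refl) j∉L
... | no _     | no _     = deleteAll-∉ L B (i∉L ∘ there) (j∉L ∘ there)

deleteAll-∈ : ∀ {n} L (B : Matrix n n) {i j} → i ∈ L ⊎ j ∈ L → deleteAll L B i j ≡ δ i j
deleteAll-∈ []      B (inj₁ ())
deleteAll-∈ []      B (inj₂ ())
deleteAll-∈ (v ∷ L) B {i} {j} ∈L with v ≟ i | v ≟ j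
... | yes _  | yes _  = refl
... | yes _  | no _   = refl
... | no _   | yes _  = refl
... | no v≢i | no v≢j = deleteAll-∈ L B (remaining ∈L)
  where
  remaining : i ∈ v ∷ L ⊎ j ∈ v ∷ L → i ∈ L ⊎ j ∈ L
  remaining (inj₁ (here i≡v))  = contradiction (sym i≡v) v≢i
  remaining (inj₁ (there i∈L)) = inj₁ i∈L
  remaining (inj₂ (here j≡v))  = contradiction (sym j≡v) v≢j
  remaining (inj₂ (there j∈L)) = inj₂ j∈L

-- The tail is deleted before the head; `Unique` guarantees that the head still has weight 1 when
-- its turn comes.
interlacing-list : ∀ {n} m (B : Matrix n n) → Symmetric B → ∀ L → Unique L →
  Vanishes (length L ℕ.+ m) (λ x → detℤ n (pencil B (const 1ℤ) x)) →
  Vanishes m (λ x → detℤ n (pencil (deleteAll L B) (deleteWeights L) x))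
interlacing-list m B B-sym []      _            vanishes = vanishes
interlacing-list {n} m B B-sym (v ∷ L) unique@(_ ∷ L-unique) vanishes =
  interlacing m (deleteAll L B) (deleteWeights L) (deleteAll-symmetric L B-sym) v
    (deleteWeights-∉ L (Uniqueₚ.Unique[x∷xs]⇒x∉xs unique))
    (interlacing-list (suc m) B B-sym L L-unique
      (subst (λ k → Vanishes k (λ x → detℤ n (pencil B (const 1ℤ) x))) (sym (ℕₚ.+-suc (length L) m)) vanishes))

-- Principal submatrices extended by the identity

Nonsingular : ∀ {n} → Matrix n n → Set
Nonsingular {n} M = detℤ n M ≢ 0ℤ

nonsingular-cong : ∀ {n} (M P : Matrix n n) → (∀ i → M i ≗ P i) → Nonsingular P → Nonsingular M
nonsingular-cong {n} M P eq P≢0 M≡0 = P≢0 (trans (sym (detℤ-cong n eq)) M≡0)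

detℤ-δ : ∀ n → detℤ n δ ≡ 1ℤ
detℤ-δ zero    = refl
detℤ-δ (suc n) = begin
  1ℤ * detℤ n (minor {n} {n} δ zero) + sum {n} (λ j → (altSign (suc (toℕ j)) * 0ℤ) * detℤ n (minor {n} {n} δ (suc j)))
    ≡⟨ cong₂ _+_ (trans (ℤₚ.*-identityˡ _) (trans (detℤ-cong n δ-suc) (detℤ-δ n)))
         (sum-0 {n} (λ j → trans (cong (_* detℤ n (minor {n} {n} δ (suc j))) (ℤₚ.*-zeroʳ (altSign (suc (toℕ j)))))
                             (ℤₚ.*-zeroˡ (detℤ n (minor {n} {n} δ (suc j)))))) ⟩
  1ℤ + 0ℤ ≡⟨⟩
  1ℤ ∎
  where open ≡-Reasoning

-- The identity matrix of size n with N placed in the rows and columns ψ.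
module Embedding {k n} (ψ : Fin k → Fin n) (ψ-injective : Injective _≡_ _≡_ ψ) where

  Image : Fin n → Set
  Image i = ∃ λ a → ψ a ≡ i

  image? : ∀ i → Dec (Image i)
  image? i = any? (λ a → ψ a ≟ i)

  entry : Matrix k k → (i j : Fin n) → Dec (Image i) → Dec (Image j) → ℤ
  entry N i j (yes (a , _)) (yes (b , _)) = N a b
  entry N i j (yes _)       (no _)        = 0ℤ
  entry N i j (no _)        _             = δ i j

  embed : Matrix k k → Matrix n n
  embed N i j = entry N i j (image? i) (image? j)

  embed-image : ∀ N a b → embed N (ψ a) (ψ b) ≡ N a b
  embed-image N a b with image? (ψ a) | image? (ψ b)
  ... | yes (a′ , a≡) | yes (b′ , b≡) = cong₂ N (ψ-injective a≡) (ψ-injective b≡)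
  ... | yes _         | no ∄b         = contradiction (b , refl) ∄b
  ... | no ∄a         | _             = contradiction (a , refl) ∄a

  embed-outside : ∀ N {i j} → ¬ Image i ⊎ ¬ Image j → embed N i j ≡ δ i j
  embed-outside N {i} {j} outside with image? i | image? j
  ... | no _           | _              = refl
  ... | yes (a , refl) | no ∄j          = sym (δ-≢ λ ψa≡j → ∄j (a , ψa≡j))
  ... | yes i∈         | yes j∈ with outside
  ...   | inj₁ i∉ = contradiction i∈ i∉
  ...   | inj₂ j∉ = contradiction j∈ j∉

  embed-unique : ∀ (M : Matrix n n) N → (∀ a b → M (ψ a) (ψ b) ≡ N a b) →
                 (∀ {i j} → ¬ Image i ⊎ ¬ Image j → M i j ≡ δ i j) → ∀ i → M i ≗ embed N i
  embed-unique M N inside outside i j with image? i | image? j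
  ... | yes (a , refl) | yes (b , refl) = inside a b
  ... | yes (a , refl) | no ∄j          = trans (outside (inj₂ ∄j)) (δ-≢ λ ψa≡j → ∄j (a , ψa≡j))
  ... | no ∄i          | _              = outside (inj₁ ∄i)

  embed-δ : ∀ i → δ i ≗ embed δ i
  embed-δ = embed-unique δ δ δ-ψ (λ _ → refl)
    where
    δ-ψ : ∀ a b → δ (ψ a) (ψ b) ≡ δ a b
    δ-ψ a b with a ≟ b
    ... | yes refl = δ-refl (ψ a)
    ... | no a≢b   = δ-≢ (a≢b ∘ ψ-injective)

  embed-row : ∀ {M N a b} → M a ≗ N b → ∀ j → Image j → embed M (ψ a) j ≡ embed N (ψ b) j
  embed-row {M} {N} {a} {b} eq _ (c , refl) =
    trans (embed-image M a c) (trans (eq c) (sym (embed-image N b c)))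

  embed-alternating : Alternating (detℤ n ∘ embed)
  embed-alternating = record
    { cong-rows  = λ eq → cong-rows (λ i → row-cong i (λ { a refl → eq a }))
    ; linear     = λ a₀ c {M} {P} {Q} MP MQ eq → linear (ψ a₀) c
        (λ i i≢ → row-cong i (λ { a refl → MP a (i≢ ∘ cong ψ) }))
        (λ i i≢ → row-cong i (λ { a refl → MQ a (i≢ ∘ cong ψ) }))
        (λ j → linear-row M P Q a₀ c eq j (image? j))
    ; equal-rows = λ {a} {b} {M} a≢b eq →
        equal-rows (a≢b ∘ ψ-injective) (λ j → equal-row M a b eq j (image? j))
    }
    where
    open Alternating (detℤ-alternating n)
    row-cong : ∀ {M N} i → (∀ a → ψ a ≡ i → M a ≗ N a) → embed M i ≗ embed N i
    row-cong i eq j with image? i | image? j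
    ... | yes (a , p) | yes (b , _) = eq a p b
    ... | yes _       | no _        = refl
    ... | no _        | _           = refl
    off-image : ∀ N a {j} → ¬ Image j → embed N (ψ a) j ≡ 0ℤ
    off-image N a ∄j = trans (embed-outside N (inj₂ ∄j)) (δ-≢ λ ψa≡j → ∄j (a , ψa≡j))
    linear-row : ∀ M P Q a₀ c → (∀ b → M a₀ b ≡ c * P a₀ b + Q a₀ b) → ∀ j → Dec (Image j) →
                 embed M (ψ a₀) j ≡ c * embed P (ψ a₀) j + embed Q (ψ a₀) j
    linear-row M P Q a₀ c eq _ (yes (b , refl)) = trans (embed-image M a₀ b) (trans (eq b)
      (sym (cong₂ (λ p q → c * p + q) (embed-image P a₀ b) (embed-image Q a₀ b))))
    linear-row M P Q a₀ c eq j (no ∄j) = trans (off-image M a₀ ∄j) (sym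
      (trans (cong₂ (λ p q → c * p + q) (off-image P a₀ ∄j) (off-image Q a₀ ∄j))
             (trans (ℤₚ.+-identityʳ (c * 0ℤ)) (ℤₚ.*-zeroʳ c))))
    equal-row : ∀ M a b → M a ≗ M b → ∀ j → Dec (Image j) → embed M (ψ a) j ≡ embed M (ψ b) j
    equal-row M a b eq j (yes j∈) = embed-row eq j j∈
    equal-row M a b eq j (no ∄j)  = trans (off-image M a ∄j) (sym (off-image M b ∄j))

  -- `ψ` may scatter and permute the indices, so no block form is available. The left side is
  -- instead alternating in `N` with value 1 at `δ`, which determines it.
  detℤ-embed : ∀ N → detℤ n (embed N) ≡ detℤ k N
  detℤ-embed N = begin
    detℤ n (embed N)              ≡⟨ alternating-unique k embed-alternating N ⟩
    detℤ k N * detℤ n (embed δ)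
      ≡⟨ cong (detℤ k N *_) (trans (detℤ-cong n (λ i j → sym (embed-δ i j))) (detℤ-δ n)) ⟩
    detℤ k N * 1ℤ                 ≡⟨ ℤₚ.*-identityʳ (detℤ k N) ⟩
    detℤ k N                      ∎
    where open ≡-Reasoning

-- Multiplicity bound from a nonsingular principal submatrix

module _ {A : Set} where

  unique-⊆-length : ∀ {xs ys : List A} → Unique xs → (∀ {x} → x ∈ xs → x ∈ ys) → length xs ≤ length ys
  unique-⊆-length {[]}     _                _   = z≤n
  unique-⊆-length {x ∷ xs} {ys} (x∉ ∷ unique) xs⊆ with ∈-∃++ (xs⊆ (here refl))
  ... | as , bs , refl = subst (suc (length xs) ≤_) (sym length-ys)
                           (s≤s (unique-⊆-length unique remove))
    where
    length-ys : length (as ++ x ∷ bs) ≡ suc (length (as ++ bs))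
    length-ys = trans (length-++ as) (trans (ℕₚ.+-suc (length as) (length bs)) (cong suc (sym (length-++ as))))
    remove : ∀ {z} → z ∈ xs → z ∈ as ++ bs
    remove z∈ with ∈-++⁻ as (xs⊆ (there z∈))
    ... | inj₁ z∈as         = ∈-++⁺ˡ z∈as
    ... | inj₂ (here refl)  = contradiction refl (All.lookup x∉ z∈)
    ... | inj₂ (there z∈bs) = ∈-++⁺ʳ as z∈bs

zeroMult-charPoly-≤ : ∀ {n k} (A : Matrix n n) → Symmetric A →
  (ψ : Fin k → Fin n) → Injective _≡_ _≡_ ψ →
  Nonsingular (λ a b → - A (ψ a) (ψ b)) → zeroMult (charPoly A) ≤ n ∸ k
zeroMult-charPoly-≤ {n} {k} A A-sym ψ ψ-injective det≢0
  with zeroMult (charPoly A) ℕ.≤? n ∸ k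
... | yes ≤n∸k = ≤n∸k
... | no ≰n∸k  = contradiction (begin
  detℤ k N                   ≡⟨ sym (detℤ-embed N) ⟩
  detℤ n (embed N)
    ≡⟨ sym (detℤ-cong n (embed-unique (pencil (deleteAll L B) (deleteWeights L) 0ℤ) N
         (λ a b → trans (at-0 (ψ a) (ψ b)) (deleteAll-∉ L B (image∉L a) (image∉L b)))
         (λ {i} {j} outside → trans (at-0 i j) (deleteAll-∈ L B (outside∈L outside))))) ⟩
  detℤ n (pencil (deleteAll L B) (deleteWeights L) 0ℤ)
    ≡⟨ proj₂ final 0ℤ ⟩
  0ℤ ^ 1 * eval 0ℤ (proj₁ final)   ≡⟨ ℤₚ.*-zeroˡ (eval 0ℤ (proj₁ final)) ⟩
  0ℤ                         ∎) det≢0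
  where
  open ≡-Reasoning
  open Embedding ψ ψ-injective
  B : Matrix n n
  B i j = - A i j
  N : Matrix k k
  N a b = B (ψ a) (ψ b)
  L : List (Fin n)
  L = filter (λ i → ¬? (image? i)) (allFin n)
  L-unique : Unique L
  L-unique = Uniqueₚ.filter⁺ (λ i → ¬? (image? i)) (Uniqueₚ.allFin⁺ n)
  image∉L : ∀ a → ψ a ∉ L
  image∉L a ∈L = proj₂ (∈-filter⁻ (λ i → ¬? (image? i)) {xs = allFin n} ∈L) (a , refl)
  outside∈L : ∀ {i j} → ¬ Image i ⊎ ¬ Image j → i ∈ L ⊎ j ∈ L
  outside∈L {i} {j} (inj₁ ∄i) = inj₁ (∈-filter⁺ (λ i → ¬? (image? i)) (∈-allFin i) ∄i)
  outside∈L {i} {j} (inj₂ ∄j) = inj₂ (∈-filter⁺ (λ i → ¬? (image? i)) (∈-allFin j) ∄j)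
  k+L≤n : k ℕ.+ length L ≤ n
  k+L≤n = subst₂ _≤_ (trans (length-++ (tabulate ψ)) (cong (ℕ._+ length L) (length-tabulate ψ)))
                     (length-tabulate id)
    (unique-⊆-length {xs = tabulate ψ ++ L} {ys = allFin n}
      (Uniqueₚ.++⁺ (Uniqueₚ.tabulate⁺ ψ-injective) L-unique
        (λ { (∈ψ , ∈L) → case-tabulate ∈ψ ∈L }))
      (λ {x} _ → ∈-allFin x))
    where
    case-tabulate : ∀ {i} → i ∈ tabulate ψ → i ∉ L
    case-tabulate ∈ψ with ∈-tabulate⁻ {f = ψ} ∈ψ
    ... | a , refl = image∉L a
  -- `length L` is at most `n ∸ k`, so a multiplicity above `n ∸ k` pays for deleting all of `L` and
  -- leaves order at least 1, which forces the value at 0 to vanish.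
  many : length L ℕ.+ 1 ≤ zeroMult (charPoly A)
  many = ℕₚ.≤-trans (ℕₚ.≤-reflexive (ℕₚ.+-comm (length L) 1))
    (ℕₚ.≤-trans (s≤s (ℕₚ.m+n≤o⇒m≤o∸n (length L) (subst (_≤ n) (ℕₚ.+-comm k (length L)) k+L≤n)))
                (ℕₚ.≰⇒> ≰n∸k))
  eval-entry : ∀ x i j → eval x ((if does (i ≟ j) then (0ℤ ∷ 1ℤ ∷ []) else []) +ₚ (- A i j ∷ [])) ≡
                         pencil B (const 1ℤ) x i j
  eval-entry x i j with i ≟ j
  ... | yes _ = diagonal x (- A i j)
    where
    diagonal : ∀ x b → (0ℤ + b) + x * (1ℤ + x * 0ℤ) ≡ b + x * ((1ℤ * 1ℤ) * 1ℤ)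
    diagonal = solve-∀
  ... | no _  = off-diagonal x (- A i j)
    where
    off-diagonal : ∀ x b → b + x * 0ℤ ≡ b + x * ((1ℤ * 1ℤ) * 0ℤ)
    off-diagonal = solve-∀
  final : Vanishes 1 (λ x → detℤ n (pencil (deleteAll L B) (deleteWeights L) x))
  final = interlacing-list 1 B (λ i j → cong -_ (A-sym i j)) L L-unique
    (vanishes-cong (length L ℕ.+ 1) (λ x → sym (trans (eval-det x n _) (detℤ-cong n (eval-entry x))))
      (zeroMult-vanishes (length L ℕ.+ 1) (charPoly A) many))
  at-0 : ∀ i j → pencil (deleteAll L B) (deleteWeights L) 0ℤ i j ≡ deleteAll L B i j
  at-0 i j = trans (cong (λ y → deleteAll L B i j + y) (ℤₚ.*-zeroˡ ((deleteWeights L i * deleteWeights L i) * δ i j))) (ℤₚ.+-identityʳ (deleteAll L B i j))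


-- Counting edges

isEdge : ∀ {n} → Graph n → Fin n × Fin n → Bool
isEdge G (i , j) = adj G i j ∧ (toℕ i ℕ.<ᵇ toℕ j)

edges : ∀ {n} → Graph n → List (Fin n × Fin n)
edges {n} G = filter (λ e → T? (isEdge G e)) (cartesianProduct (allFin n) (allFin n))

count-pairs : ∀ {A B : Set} (p : A × B → Bool) (xs : List A) (ys : List B) →
  ListAction.sum (concatMap (λ x → map (λ y → if p (x , y) then 1 else 0) ys) xs) ≡
  length (filter (λ e → T? (p e)) (cartesianProduct xs ys))
count-pairs         p []       ys = refl
count-pairs {A} {B} p (x ∷ xs) ys = begin
  ListAction.sum (row ys ++ concatMap (λ x → map (λ y → if p (x , y) then 1 else 0) ys) xs)
    ≡⟨ sum-++ (row ys) _ ⟩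
  ListAction.sum (row ys) ℕ.+ _
    ≡⟨ cong₂ ℕ._+_ (count-row ys) (count-pairs p xs ys) ⟩
  length (select (map (x ,_) ys)) ℕ.+ length (select (cartesianProduct xs ys))
    ≡⟨ sym (length-++ (select (map (x ,_) ys))) ⟩
  length (select (map (x ,_) ys) ++ select (cartesianProduct xs ys))
    ≡⟨ cong length (sym (filter-++ (λ e → T? (p e)) (map (x ,_) ys) (cartesianProduct xs ys))) ⟩
  length (select (map (x ,_) ys ++ cartesianProduct xs ys)) ∎
  where
  open ≡-Reasoning
  select : List (A × B) → List (A × B)
  select = filter (λ e → T? (p e))
  row : List B → List ℕ
  row = map (λ y → if p (x , y) then 1 else 0)
  count-row : ∀ ys → ListAction.sum (row ys) ≡ length (select (map (x ,_) ys))
  count-row []       = refl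
  count-row (y ∷ ys) with p (x , y)
  ... | true  = cong suc (count-row ys)
  ... | false = count-row ys

edgeCount-length : ∀ {n} (G : Graph n) → edgeCount G ≡ length (edges G)
edgeCount-length {n} G = count-pairs (isEdge G) (allFin n) (allFin n)

-- `edges` lists every edge with its smaller end first, whereas an embedding need not preserve the
-- order of the vertices.
orient : ∀ {n} → Fin n → Fin n → Fin n × Fin n
orient u w = if toℕ u ℕ.<ᵇ toℕ w then (u , w) else (w , u)

orient-cases : ∀ {n} (u w : Fin n) → orient u w ≡ (u , w) ⊎ orient u w ≡ (w , u)
orient-cases u w with toℕ u ℕ.<ᵇ toℕ w
... | true  = inj₁ refl
... | false = inj₂ refl

orient-∈-edges : ∀ {n} (G : Graph n) {u w} → adj G u w ≡ true → orient u w ∈ edges G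
orient-∈-edges {n} G {u} {w} u~w = ∈-filter⁺ (λ e → T? (isEdge G e))
  (∈-cartesianProduct⁺ (∈-allFin _) (∈-allFin _)) is-edge
  where
  u≢w : u ≢ w
  u≢w refl with trans (sym u~w) (irrefl G u)
  ... | ()
  is-edge : T (isEdge G (orient u w))
  is-edge with toℕ u ℕ.<ᵇ toℕ w in eq
  ... | true rewrite u~w | eq = _
  ... | false rewrite trans (adj-sym G w u) u~w = ℕₚ.<⇒<ᵇ (ℕₚ.≤∧≢⇒< w≤u (u≢w ∘ sym ∘ toℕ-injective))
    where
    w≤u : toℕ w ≤ toℕ u
    w≤u = ℕₚ.≮⇒≥ (λ u<w → subst T eq (ℕₚ.<⇒<ᵇ u<w))

crossing : ∀ {n} (G : Graph n) (W : List (Fin n)) {u v} → Reach G u v → u ∈ W → v ∉ W →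
           ∃ λ a → ∃ λ b → a ∈ W × b ∉ W × adj G a b ≡ true
crossing G W here u∈W v∉W = contradiction u∈W v∉W
crossing {n} G W (step {u} {w} u~w path) u∈W v∉W with DecMembership._∈?_ (_≟_ {n}) w W
... | yes w∈W = crossing G W path w∈W v∉W
... | no w∉W  = u , w , u∈W , w∉W , u~w

Spans : ∀ {n} → List (Fin n) → List (Fin n × Fin n) → Set
Spans W E = ∀ {e} → e ∈ E → proj₁ e ∈ W × proj₂ e ∈ W

-- Each vertex outside W is reached by one new edge.
edgeCount-≥ : ∀ {n} (G : Graph n) → Connected G → ∀ c {w} W E → w ∈ W → Unique W → Unique E →
  (∀ {e} → e ∈ E → e ∈ edges G) → Spans W E → length W ℕ.+ c ≤ length E → n ℕ.+ c ≤ edgeCount G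
edgeCount-≥ {n} G connected c W₀ E₀ w∈W₀ = grow n W₀ E₀ (ℕₚ.m≤n+m n (length W₀)) w∈W₀
  where
  open DecMembership (_≟_ {n}) using (_∈?_)
  -- `fuel` bounds the number of vertices missing from `W`. Every round adds one vertex and one
  -- edge, so the excess `c` of edges over vertices is kept.
  grow : ∀ fuel {w} W E → n ≤ length W ℕ.+ fuel → w ∈ W → Unique W → Unique E →
    (∀ {e} → e ∈ E → e ∈ edges G) → Spans W E → length W ℕ.+ c ≤ length E → n ℕ.+ c ≤ edgeCount G
  grow fuel {w} W E n≤ w∈W W-unique E-unique E⊆ spans W≤E with any? (λ v → ¬? (v ∈? W))
  ... | no all-in = begin
    n ℕ.+ c                   ≡⟨ cong (ℕ._+ c) (sym (length-tabulate id)) ⟩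
    length (allFin n) ℕ.+ c   ≤⟨ ℕₚ.+-monoˡ-≤ c (unique-⊆-length (Uniqueₚ.allFin⁺ n) (λ {v} _ → in-W v)) ⟩
    length W ℕ.+ c            ≤⟨ W≤E ⟩
    length E                  ≤⟨ unique-⊆-length E-unique E⊆ ⟩
    length (edges G)          ≡⟨ sym (edgeCount-length G) ⟩
    edgeCount G               ∎
    where
    open ℕₚ.≤-Reasoning
    in-W : ∀ v → v ∈ W
    in-W v with v ∈? W
    ... | yes v∈W = v∈W
    ... | no v∉W  = contradiction (v , v∉W) all-in
  ... | yes (x , x∉W) with crossing G W (connected w x) w∈W x∉W
  ...   | a , b , a∈W , b∉W , a~b = next fuel n≤
    where
    W′-unique : Unique (b ∷ W)
    W′-unique = Allₚ.¬Any⇒All¬ W b∉W ∷ W-unique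
    new-∉E : orient a b ∉ E
    new-∉E ∈E with spans ∈E | orient-cases a b
    ... | _ , b∈W | inj₁ eq = b∉W (subst (_∈ W) (cong proj₂ eq) b∈W)
    ... | b∈W , _ | inj₂ eq = b∉W (subst (_∈ W) (cong proj₁ eq) b∈W)
    spans′ : Spans (b ∷ W) (orient a b ∷ E)
    spans′ (here refl) with orient-cases a b
    ... | inj₁ eq = subst (λ e → proj₁ e ∈ b ∷ W × proj₂ e ∈ b ∷ W) (sym eq) (there a∈W , here refl)
    ... | inj₂ eq = subst (λ e → proj₁ e ∈ b ∷ W × proj₂ e ∈ b ∷ W) (sym eq) (here refl , there a∈W)
    spans′ (there e∈E) = there (proj₁ (spans e∈E)) , there (proj₂ (spans e∈E))
    next : ∀ fuel → n ≤ length W ℕ.+ fuel → n ℕ.+ c ≤ edgeCount G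
    next zero n≤W = contradiction (ℕₚ.≤-trans (unique-⊆-length W′-unique (λ {v} _ → ∈-allFin v))
        (ℕₚ.≤-trans (ℕₚ.≤-reflexive (length-tabulate id)) (subst (n ≤_) (ℕₚ.+-identityʳ (length W)) n≤W)))
      ℕₚ.1+n≰n
    next (suc fuel) n≤W = grow fuel (b ∷ W) (orient a b ∷ E)
      (subst (n ≤_) (ℕₚ.+-suc (length W) fuel) n≤W) (here refl) W′-unique
      (Allₚ.¬Any⇒All¬ E new-∉E ∷ E-unique)
      (λ { (here refl) → orient-∈-edges G a~b ; (there e∈E) → E⊆ e∈E })
      spans′ (s≤s W≤E)

orient-injective : ∀ {n} {u w u′ w′ : Fin n} → orient u w ≡ orient u′ w′ →
                   (u ≡ u′ × w ≡ w′) ⊎ (u ≡ w′ × w ≡ u′)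
orient-injective {u = u} {w} {u′} {w′} eq with orient-cases u w | orient-cases u′ w′
... | inj₁ p | inj₁ q = let r = trans (sym p) (trans eq q) in inj₁ (cong proj₁ r , cong proj₂ r)
... | inj₁ p | inj₂ q = let r = trans (sym p) (trans eq q) in inj₂ (cong proj₁ r , cong proj₂ r)
... | inj₂ p | inj₁ q = let r = trans (sym p) (trans eq q) in inj₂ (cong proj₂ r , cong proj₁ r)
... | inj₂ p | inj₂ q = let r = trans (sym p) (trans eq q) in inj₁ (cong proj₂ r , cong proj₁ r)

unique-map : ∀ {A B : Set} (f : A → B) {xs} → (∀ {x y} → x ∈ xs → y ∈ xs → f x ≡ f y → x ≡ y) →
             Unique xs → Unique (map f xs)
unique-map f inj []            = []
unique-map f inj (x∉ ∷ unique) =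
  Allₚ.map⁺ (All.tabulate (λ y∈ fx≡fy → All.lookup x∉ y∈ (inj (here refl) (there y∈) fx≡fy)))
    ∷ unique-map f (λ x∈ y∈ → inj (there x∈) (there y∈)) unique

-- A connected graph has at least the excess of edges over vertices of any nonempty subgraph. The
-- pairs in `P` are increasing so that no edge is counted in both orientations.
edgeCount-≥-subgraph : ∀ {n N} (G : Graph n) → Connected G → ∀ c (φ : Fin (suc N) → Fin n) →
  Injective _≡_ _≡_ φ → ∀ P → Unique P →
  (∀ {e} → e ∈ P → toℕ (proj₁ e) < toℕ (proj₂ e) × adj G (φ (proj₁ e)) (φ (proj₂ e)) ≡ true) →
  suc N ℕ.+ c ≤ length P → n ℕ.+ c ≤ edgeCount G
edgeCount-≥-subgraph {N = N} G connected c φ φ-injective P P-unique P-edges N≤P =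
  edgeCount-≥ G connected c (tabulate φ) (map image P) (here refl)
    (Uniqueₚ.tabulate⁺ φ-injective) (unique-map image image-injective P-unique)
    image-edge image-spans
    (subst₂ (λ s t → s ℕ.+ c ≤ t) (sym (length-tabulate φ)) (sym (length-map image P)) N≤P)
  where
  image : Fin (suc N) × Fin (suc N) → _
  image (a , b) = orient (φ a) (φ b)
  image-injective : ∀ {x y} → x ∈ P → y ∈ P → image x ≡ image y → x ≡ y
  image-injective {a , b} {a′ , b′} x∈ y∈ eq with orient-injective eq
  ... | inj₁ (p , q) = cong₂ _,_ (φ-injective p) (φ-injective q)
  ... | inj₂ (p , q) with refl ← φ-injective p | refl ← φ-injective q =
    contradiction (proj₁ (P-edges x∈)) (ℕₚ.<-asym (proj₁ (P-edges y∈)))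
  image-edge : ∀ {e} → e ∈ map image P → e ∈ edges G
  image-edge ∈map with ∈-map⁻ image ∈map
  ... | (a , b) , ∈P , refl = orient-∈-edges G (proj₂ (P-edges ∈P))
  image-spans : Spans (tabulate φ) (map image P)
  image-spans ∈map with ∈-map⁻ image ∈map
  ... | (a , b) , _ , refl with orient-cases (φ a) (φ b)
  ...   | inj₁ eq = subst (λ e → proj₁ e ∈ tabulate φ × proj₂ e ∈ tabulate φ) (sym eq)
                      (∈-tabulate⁺ {f = φ} a , ∈-tabulate⁺ {f = φ} b)
  ...   | inj₂ eq = subst (λ e → proj₁ e ∈ tabulate φ × proj₂ e ∈ tabulate φ) (sym eq)
                      (∈-tabulate⁺ {f = φ} b , ∈-tabulate⁺ {f = φ} a)

-- The copy of ∞(p,q,l) in a bicyclic graph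

InfEdge-< : ∀ {p q l i j} → InfEdge (3 ℕ.+ p) (3 ℕ.+ q) l i j → i < j
InfEdge-< (chain i _)         = ℕₚ.n<1+n i
InfEdge-< closeP              = s≤s z≤n
InfEdge-< {p} {q} {l} closeQ  = ℕₚ.+-monoˡ-≤ l (subst (suc (suc p) ≤_) (sym (ℕₚ.+-suc p (2 ℕ.+ q)))
  (s≤s (subst (suc p ≤_) (sym (ℕₚ.+-suc p (1 ℕ.+ q))) (s≤s (ℕₚ.m≤m+n p (suc q))))))

-- Any other edge between vertices of ∞(p,q,l) would be the (n+2)-nd edge.
module _ {n} (G : Graph n) (bicyclic : Bicyclic G) (p q l : ℕ)
         (contains : ContainsInf G (3 ℕ.+ p) (3 ℕ.+ q) l) where

  private
    -- `infSize` computes to `suc M`: `M` is both the last vertex of ∞(p,q,l) and the number of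
    -- chain edges.
    M : ℕ
    M = p ℕ.+ (3 ℕ.+ q) ℕ.+ l
    φ : Fin (suc M) → Fin n
    φ = proj₁ contains
    InfPair : Fin (suc M) × Fin (suc M) → Set
    InfPair (a , b) = InfEdge (3 ℕ.+ p) (3 ℕ.+ q) l (toℕ a) (toℕ b)

    corner-< : 2 ℕ.+ p < suc M
    corner-< = s≤s (ℕₚ.≤-trans (subst (2 ℕ.+ p ≤_) (ℕₚ.+-comm (3 ℕ.+ q) p)
      (s≤s (s≤s (ℕₚ.m≤n+m p (suc q))))) (ℕₚ.m≤m+n (p ℕ.+ (3 ℕ.+ q)) l))

    junction-< : suc (p ℕ.+ l) < suc M
    junction-< = ℕₚ.m<n⇒m<1+n (InfEdge-< {p} {q} {l} closeQ)

    pairP pairQ : Fin (suc M) × Fin (suc M)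
    pairP = zero , fromℕ< corner-<
    pairQ = fromℕ< junction-< , fromℕ M

    link : Fin M → Fin (suc M) × Fin (suc M)
    link k = inject₁ k , suc k

    links : List (Fin (suc M) × Fin (suc M))
    links = tabulate link

    infPairP : InfPair pairP
    infPairP = subst (InfEdge (3 ℕ.+ p) (3 ℕ.+ q) l 0) (sym (toℕ-fromℕ< corner-<)) closeP

    infPairQ : InfPair pairQ
    infPairQ = subst₂ (InfEdge (3 ℕ.+ p) (3 ℕ.+ q) l) (sym (toℕ-fromℕ< junction-<)) (sym (toℕ-fromℕ M)) closeQ

    infLinks : ∀ {e} → e ∈ links → InfPair e
    infLinks ∈links with ∈-tabulate⁻ ∈links
    ... | k , refl = subst (λ i → InfEdge (3 ℕ.+ p) (3 ℕ.+ q) l i (suc (toℕ k)))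
                       (sym (toℕ-inject₁ k)) (chain (toℕ k) (s≤s (toℕ<n k)))

    infPairs : ∀ {e} → e ∈ pairP ∷ pairQ ∷ links → InfPair e
    infPairs (here refl)              = infPairP
    infPairs (there (here refl))      = infPairQ
    infPairs (there (there e∈links))  = infLinks e∈links

    links-step : ∀ {e} → e ∈ links → toℕ (proj₂ e) ≡ suc (toℕ (proj₁ e))
    links-step ∈links with ∈-tabulate⁻ ∈links
    ... | k , refl = cong suc (sym (toℕ-inject₁ k))

    pairP∉links : pairP ∉ links
    pairP∉links ∈links with trans (sym (toℕ-fromℕ< corner-<)) (links-step ∈links)
    ... | ()

    pairQ∉links : pairQ ∉ links
    -- The closing edge of the second cycle spans the cycle length minus one, at least 2, whereas a
    -- link spans 1.
    pairQ∉links ∈links = ℕₚ.<⇒≢ gap (sym (trans (sym (toℕ-fromℕ M))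
      (trans (links-step ∈links) (cong suc (toℕ-fromℕ< junction-<)))))
      where
      gap : suc (suc (p ℕ.+ l)) < M
      gap = ℕₚ.+-monoˡ-≤ l (subst (3 ℕ.+ p ≤_) (ℕₚ.+-comm (3 ℕ.+ q) p)
        (s≤s (s≤s (s≤s (ℕₚ.m≤n+m p q)))))

    pairP≢pairQ : pairP ≢ pairQ
    pairP≢pairQ eq with trans (cong (toℕ ∘ proj₁) eq) (toℕ-fromℕ< junction-<)
    ... | ()

    infPairs-unique : Unique (pairP ∷ pairQ ∷ links)
    infPairs-unique = (pairP≢pairQ ∷ Allₚ.¬Any⇒All¬ links pairP∉links)
                    ∷ Allₚ.¬Any⇒All¬ links pairQ∉links
                    ∷ Uniqueₚ.tabulate⁺ (λ eq → suc-injective (cong proj₂ eq))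

  no-chord : ∀ {a b : Fin (suc M)} → toℕ a < toℕ b →
             ¬ InfEdge (3 ℕ.+ p) (3 ℕ.+ q) l (toℕ a) (toℕ b) → adj G (φ a) (φ b) ≡ false
  no-chord {a} {b} a<b not-inf with adj G (φ a) (φ b) in a~b
  ... | false = refl
  ... | true  = contradiction (subst (n ℕ.+ 2 ≤_) (trans (proj₂ bicyclic) (ℕₚ.+-comm 1 n)) too-many)
                  (λ le → ℕₚ.<-irrefl refl (ℕₚ.+-cancelˡ-≤ n 2 1 le))
    where
    P-edges : ∀ {e} → e ∈ (a , b) ∷ pairP ∷ pairQ ∷ links →
      toℕ (proj₁ e) < toℕ (proj₂ e) × adj G (φ (proj₁ e)) (φ (proj₂ e)) ≡ true
    P-edges (here refl) = a<b , a~b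
    P-edges (there e∈)  = InfEdge-< (infPairs e∈) , proj₂ (proj₂ contains) _ _ (inj₁ (infPairs e∈))
    too-many : n ℕ.+ 2 ≤ edgeCount G
    too-many = edgeCount-≥-subgraph G (proj₁ bicyclic) 2 φ (proj₁ (proj₂ contains))
      ((a , b) ∷ pairP ∷ pairQ ∷ links)
      (Allₚ.¬Any⇒All¬ _ (λ e∈ → not-inf (infPairs e∈)) ∷ infPairs-unique)
      P-edges
      -- `M` links, two closing edges and the chord make `M + 3` pairs on `M + 1` vertices: excess
      -- 2, against excess 1 in a bicyclic graph.
      (ℕₚ.≤-reflexive (trans (cong suc (ℕₚ.+-comm M 2)) (cong (λ k → 3 ℕ.+ k) (sym (length-tabulate link)))))

-- The six vertices p-3 , … , p+2 of ∞(p,q,l)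

-- Arguments are positions inside the window, from 0 to 5. The triangle 012 occurs when the first
-- cycle has length 3; the triangle 345 when the second has length 3 and the path has two vertices.
data Near : ℕ → ℕ → Set where
  successor : ∀ {a} → Near a (suc a)
  triangleP : Near 0 2
  triangleQ : Near 3 5

near? : ∀ a b → Dec (Near a b)
near? a b = map′ to from ((b ℕ.≟ suc a) ⊎-dec ((a ℕ.≟ 0) ×-dec (b ℕ.≟ 2)) ⊎-dec ((a ℕ.≟ 3) ×-dec (b ℕ.≟ 5)))
  where
  to : b ≡ suc a ⊎ (a ≡ 0 × b ≡ 2) ⊎ (a ≡ 3 × b ≡ 5) → Near a b
  to (inj₁ refl)                 = successor
  to (inj₂ (inj₁ (refl , refl))) = triangleP
  to (inj₂ (inj₂ (refl , refl))) = triangleQ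
  from : Near a b → b ≡ suc a ⊎ (a ≡ 0 × b ≡ 2) ⊎ (a ≡ 3 × b ≡ 5)
  from successor = inj₁ refl
  from triangleP = inj₂ (inj₁ (refl , refl))
  from triangleQ = inj₂ (inj₂ (refl , refl))

-- `closeP` starts at vertex 0, which lies in the window only for a first cycle of length 3. Since
-- the path has at least two vertices, `closeQ` starts at position 3 or later and ends at position 5
-- or later, so `b ≤ 5` leaves only the pair 3, 5. A path of one vertex would allow chords from
-- position 2.
InfEdge-near : ∀ {p q l i j} a b → b ≤ 5 → InfEdge (3 ℕ.+ p) (3 ℕ.+ q) (2 ℕ.+ l) i j →
               i ≡ p ℕ.+ a → j ≡ p ℕ.+ b → Near a b
InfEdge-near {p} a b _ (chain i _) i≡ j≡
  with refl ← ℕₚ.+-cancelˡ-≡ p b (suc a) (trans (sym j≡) (trans (cong suc i≡) (sym (ℕₚ.+-suc p a)))) = successor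
InfEdge-near {zero}  .0 .2 _ closeP refl refl = triangleP
InfEdge-near {suc p} a b _ closeP () j≡
InfEdge-near {p} {q} {l} a b b≤5 closeQ i≡ j≡
  with refl ← ℕₚ.+-cancelˡ-≡ p (3 ℕ.+ q ℕ.+ (2 ℕ.+ l)) b (trans (sym (ℕₚ.+-assoc p (3 ℕ.+ q) (2 ℕ.+ l))) j≡)
     | refl ← ℕₚ.+-cancelˡ-≡ p (3 ℕ.+ l) a (trans (ℕₚ.+-suc p (2 ℕ.+ l)) i≡)
  with q | l | b≤5
... | zero  | zero  | _ = triangleQ
... | zero  | suc l | s≤s (s≤s (s≤s (s≤s (s≤s ()))))
... | suc q | l     | s≤s (s≤s (s≤s (s≤s 2+≤1))) =
  contradiction (ℕₚ.≤-trans (ℕₚ.m≤n+m (2 ℕ.+ l) q) 2+≤1) λ { (s≤s ()) }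

-- The adjacency matrix of the path 0 – 1 – 2 – 3 – 4 – 5 with possible chords 02 and 35.
pathMatrix : (s₀ s₁ s₂ s₃ s₄ t₀ t₁ : ℤ) → Matrix 6 6
pathMatrix s₀ s₁ s₂ s₃ s₄ t₀ t₁ a b = Vec.lookup (Vec.lookup rows a) b
  where
  rows : Vec (Vec ℤ 6) 6
  rows = (0ℤ ∷ s₀ ∷ t₀ ∷ 0ℤ ∷ 0ℤ ∷ 0ℤ ∷ [])
       ∷ (s₀ ∷ 0ℤ ∷ s₁ ∷ 0ℤ ∷ 0ℤ ∷ 0ℤ ∷ [])
       ∷ (t₀ ∷ s₁ ∷ 0ℤ ∷ s₂ ∷ 0ℤ ∷ 0ℤ ∷ [])
       ∷ (0ℤ ∷ 0ℤ ∷ s₂ ∷ 0ℤ ∷ s₃ ∷ t₁ ∷ [])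
       ∷ (0ℤ ∷ 0ℤ ∷ 0ℤ ∷ s₃ ∷ 0ℤ ∷ s₄ ∷ [])
       ∷ (0ℤ ∷ 0ℤ ∷ 0ℤ ∷ t₁ ∷ s₄ ∷ 0ℤ ∷ [])
       ∷ []

-- An absent chord is a third value beside the two signs, so the seven parameters range over 2^5 *
-- 3^2 = 288 patterns and can be enumerated.
chordℤ : Maybe Sign → ℤ
chordℤ nothing  = 0ℤ
chordℤ (just s) = signℤ s

∀-sign? : {P : Sign → Set} → (∀ s → Dec (P s)) → Dec (∀ s → P s)
∀-sign? P? = map′ (λ { (p , m) Sign.+ → p ; (p , m) Sign.- → m }) (λ f → f Sign.+ , f Sign.-)
                  (P? Sign.+ ×-dec P? Sign.-)

∀-chord? : {P : Maybe Sign → Set} → (∀ t → Dec (P t)) → Dec (∀ t → P t)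
∀-chord? P? = map′ (λ { (p , f) nothing → p ; (p , f) (just s) → f s }) (λ f → f nothing , f ∘ just)
                   (P? nothing ×-dec ∀-sign? (P? ∘ just))

-- The determinant is 4 s₀ s₁ t₀ s₃ s₄ t₁ - (s₀ s₂ s₄)²; all sign patterns are evaluated.
pathMatrix-nonsingular : ∀ s₀ s₁ s₂ s₃ s₄ t₀ t₁ → Nonsingular (λ a b →
  - pathMatrix (signℤ s₀) (signℤ s₁) (signℤ s₂) (signℤ s₃) (signℤ s₄) (chordℤ t₀) (chordℤ t₁) a b)
pathMatrix-nonsingular = toWitness {a? = decision} _
  where
  decision : Dec (∀ s₀ s₁ s₂ s₃ s₄ t₀ t₁ → Nonsingular (λ a b →
    - pathMatrix (signℤ s₀) (signℤ s₁) (signℤ s₂) (signℤ s₃) (signℤ s₄) (chordℤ t₀) (chordℤ t₁) a b))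
  decision = ∀-sign? λ _ → ∀-sign? λ _ → ∀-sign? λ _ → ∀-sign? λ _ → ∀-sign? λ _ →
             ∀-chord? λ _ → ∀-chord? λ _ → ¬? (_ ℤ.≟ 0ℤ)

-- Entries of the signed adjacency matrix and the conclusion

adjMatrix-symmetric : ∀ {n} (Γ : SignedGraph n) → Symmetric (adjMatrix Γ)
adjMatrix-symmetric Γ i j rewrite adj-sym (graph Γ) i j | σ-sym Γ i j = refl

adjMatrix-edge : ∀ {n} (Γ : SignedGraph n) {i j} → adj (graph Γ) i j ≡ true →
                 adjMatrix Γ i j ≡ signℤ (σ Γ i j)
adjMatrix-edge Γ i~j rewrite i~j = refl

adjMatrix-non-edge : ∀ {n} (Γ : SignedGraph n) {i j} → adj (graph Γ) i j ≡ false →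
                     adjMatrix Γ i j ≡ 0ℤ
adjMatrix-non-edge Γ i≁j rewrite i≁j = refl

chord : ∀ {n} → SignedGraph n → Fin n → Fin n → Maybe Sign
chord Γ i j = if adj (graph Γ) i j then just (σ Γ i j) else nothing

adjMatrix-chord : ∀ {n} (Γ : SignedGraph n) i j → adjMatrix Γ i j ≡ chordℤ (chord Γ i j)
adjMatrix-chord Γ i j with adj (graph Γ) i j
... | true  = refl
... | false = refl

theorem5p3 : (n : ℕ) → 7 ≤ n → (Γ : SignedGraph n) → InBplus (graph Γ) → η Γ ≤ n ∸ 6
theorem5p3 n _ Γ (bicyclic , suc (suc (suc p)) , suc (suc (suc q)) , suc (suc l) ,
                  s≤s (s≤s (s≤s _)) , s≤s (s≤s (s≤s _)) , s≤s (s≤s _) , contains@(φ , φ-injective , φ-edges)) =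
  zeroMult-charPoly-≤ (adjMatrix Γ) (adjMatrix-symmetric Γ) ψ ψ-injective
    (nonsingular-cong (λ a b → - adjMatrix Γ (ψ a) (ψ b)) (λ a b → - path a b)
      (λ a b → cong -_ (entries a b))
      (pathMatrix-nonsingular (sign 0F 1F) (sign 1F 2F) (sign 2F 3F) (sign 3F 4F) (sign 4F 5F)
        (chord Γ (ψ 0F) (ψ 2F)) (chord Γ (ψ 3F) (ψ 5F))))
  where
  G : Graph n
  G = graph Γ
  -- Here `p` is the length of the first cycle minus 3, so position 2 is the last vertex of that
  -- cycle and position 3 its neighbour on the path.
  position-< : ∀ (a : Fin 6) → p ℕ.+ toℕ a < suc (p ℕ.+ (3 ℕ.+ q) ℕ.+ (2 ℕ.+ l))
  position-< a = s≤s (subst (p ℕ.+ toℕ a ≤_) (sym (ℕₚ.+-assoc p (3 ℕ.+ q) (2 ℕ.+ l)))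
    (ℕₚ.+-monoʳ-≤ p (ℕₚ.≤-trans (toℕ≤pred[n] a)
      (ℕₚ.+-mono-≤ (ℕₚ.m≤m+n 3 q) (ℕₚ.m≤m+n 2 l)))))
  position : Fin 6 → Fin (infSize (3 ℕ.+ p) (3 ℕ.+ q) (2 ℕ.+ l))
  position a = fromℕ< (position-< a)
  toℕ-position : ∀ a → toℕ (position a) ≡ p ℕ.+ toℕ a
  toℕ-position a = toℕ-fromℕ< (position-< a)
  ψ : Fin 6 → Fin n
  ψ = φ ∘ position
  ψ-injective : Injective _≡_ _≡_ ψ
  ψ-injective {a} {b} eq = toℕ-injective (ℕₚ.+-cancelˡ-≡ p (toℕ a) (toℕ b)
    (trans (sym (toℕ-position a)) (trans (cong toℕ (φ-injective eq)) (toℕ-position b))))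
  sign : Fin 6 → Fin 6 → Sign
  sign a b = σ Γ (ψ a) (ψ b)
  far : ∀ a b → {True (toℕ a ℕ.<? toℕ b)} → {False (near? (toℕ a) (toℕ b))} → adjMatrix Γ (ψ a) (ψ b) ≡ 0ℤ
  far a b {a<b} {not-near} = adjMatrix-non-edge Γ (no-chord G bicyclic p q (2 ℕ.+ l) contains
    (subst₂ _<_ (sym (toℕ-position a)) (sym (toℕ-position b)) (ℕₚ.+-monoʳ-< p (toWitness a<b)))
    (λ inf → toWitnessFalse not-near
      (InfEdge-near (toℕ a) (toℕ b) (toℕ≤pred[n] b) inf (toℕ-position a) (toℕ-position b))))
  far′ : ∀ b a → {True (toℕ a ℕ.<? toℕ b)} → {False (near? (toℕ a) (toℕ b))} → adjMatrix Γ (ψ b) (ψ a) ≡ 0ℤ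
  far′ b a {a<b} {not-near} = trans (adjMatrix-symmetric Γ (ψ b) (ψ a)) (far a b {a<b} {not-near})
  next : ∀ a b → {True (toℕ b ℕ.≟ suc (toℕ a))} → adjMatrix Γ (ψ a) (ψ b) ≡ signℤ (sign a b)
  next a b {b≡} = adjMatrix-edge Γ (φ-edges _ _ (inj₁ (subst₂ (InfEdge _ _ _)
    (sym (toℕ-position a)) (sym step≡) (chain (p ℕ.+ toℕ a) (subst (_< _) step≡ (toℕ<n (position b)))))))
    where
    step≡ : toℕ (position b) ≡ suc (p ℕ.+ toℕ a)
    step≡ = trans (toℕ-position b) (trans (cong (p ℕ.+_) (toWitness b≡)) (ℕₚ.+-suc p (toℕ a)))
  next′ : ∀ b a → {True (toℕ b ℕ.≟ suc (toℕ a))} → adjMatrix Γ (ψ b) (ψ a) ≡ signℤ (sign a b)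
  next′ b a {b≡} = trans (adjMatrix-symmetric Γ (ψ b) (ψ a)) (next a b {b≡})
  loop : ∀ a → adjMatrix Γ (ψ a) (ψ a) ≡ 0ℤ
  loop a = adjMatrix-non-edge Γ (irrefl G (ψ a))
  triangle : ∀ a b → adjMatrix Γ (ψ a) (ψ b) ≡ chordℤ (chord Γ (ψ a) (ψ b))
  triangle a b = adjMatrix-chord Γ (ψ a) (ψ b)
  triangle′ : ∀ b a → adjMatrix Γ (ψ b) (ψ a) ≡ chordℤ (chord Γ (ψ a) (ψ b))
  triangle′ b a = trans (adjMatrix-symmetric Γ (ψ b) (ψ a)) (triangle a b)
  path : Matrix 6 6
  path = pathMatrix (signℤ (sign 0F 1F)) (signℤ (sign 1F 2F)) (signℤ (sign 2F 3F)) (signℤ (sign 3F 4F))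
                    (signℤ (sign 4F 5F)) (chordℤ (chord Γ (ψ 0F) (ψ 2F))) (chordℤ (chord Γ (ψ 3F) (ψ 5F)))
  entries : ∀ a b → adjMatrix Γ (ψ a) (ψ b) ≡ path a b
  entries 0F 0F = loop 0F
  entries 0F 1F = next 0F 1F
  entries 0F 2F = triangle 0F 2F
  entries 0F 3F = far 0F 3F
  entries 0F 4F = far 0F 4F
  entries 0F 5F = far 0F 5F
  entries 1F 0F = next′ 1F 0F
  entries 1F 1F = loop 1F
  entries 1F 2F = next 1F 2F
  entries 1F 3F = far 1F 3F
  entries 1F 4F = far 1F 4F
  entries 1F 5F = far 1F 5F
  entries 2F 0F = triangle′ 2F 0F
  entries 2F 1F = next′ 2F 1F
  entries 2F 2F = loop 2F
  entries 2F 3F = next 2F 3F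
  entries 2F 4F = far 2F 4F
  entries 2F 5F = far 2F 5F
  entries 3F 0F = far′ 3F 0F
  entries 3F 1F = far′ 3F 1F
  entries 3F 2F = next′ 3F 2F
  entries 3F 3F = loop 3F
  entries 3F 4F = next 3F 4F
  entries 3F 5F = triangle 3F 5F
  entries 4F 0F = far′ 4F 0F
  entries 4F 1F = far′ 4F 1F
  entries 4F 2F = far′ 4F 2F
  entries 4F 3F = next′ 4F 3F
  entries 4F 4F = loop 4F
  entries 4F 5F = next 4F 5F
  entries 5F 0F = far′ 5F 0F
  entries 5F 1F = far′ 5F 1F
  entries 5F 2F = far′ 5F 2F
  entries 5F 3F = triangle′ 5F 3F
  entries 5F 4F = next′ 5F 4F
  entries 5F 5F = loop 5F
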